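{- Let $p$ be an odd prime, let $\mathbb{P}=\mathbb{C}_p[x]$, and let $r\ge1$ be an integer. For every polynomial $q(x)\in\mathbb{P}$, $$\underbrace{\int_{\mathbb{Z}_p}\cdots\int_{\mathbb{Z}_p}}_{r\text{ times}}q(x_1+\cdots+x_r+x)\,d\mu_{ -1}(x_1)\cdots d\mu_{ -1}(x_r)=\left(\frac{2}{e^t+1}\right)^r q(x).$$ In particular, for every integer $n\ge0$, $$E_n^{(r)}(x)=\left(\frac{2}{e^t+1}\right)^r x^n=\left(\int_{\mathbb{Z}_p}\cdots\int_{\mathbb{Z}_p}e^{(x_1+\cdots+x_r)t}\,d\mu_{ -1}(x_1)\cdots d\mu_{ -1}(x_r)\right)x^n .$$ That is, $E_n^{(r)}(x)$ is the Appell sequence $$E_n^{(r)}(x)\sim\left(\frac{1}{\int_{\mathbb{Z}_p}\cdots\int_{\mathbb{Z}_p}e^{(x_1+\cdots+x_r)t}\,d\mu_{ -1}(x_1)\cdots d\mu_{ -1}(x_r)},\ t\right).$$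
   Context: $p$ is a fixed odd prime; $\mathbb{Z}_p$ is the ring of $p$-adic integers and $\mathbb{C}_p$ is the completion of the algebraic closure of $\mathbb{Q}_p$. Fermionic $p$-adic integral: for a continuous function $f:\mathbb{Z}_p\to\mathbb{C}_p$, $$\int_{\mathbb{Z}_p}f(x)\,d\mu_{ -1}(x)=\lim_{N\to\infty}\sum_{x=0}^{p^N-1}f(x)(-1)^x .$$ Multiple integrals are iterated integrals over $x_1,\dots,x_r\in\mathbb{Z}_p$; those involving the free variable $x$ are regarded as functions (polynomials) of $x$, $x\in\mathbb{C}_p$. $\mathcal{F}$ is the algebra of formal power series $f(t)=\sum_{k\ge0}\frac{a_k}{k!}t^k$ with $a_k\in\mathbb{C}_p$. Each $f(t)\in\mathcal{F}$ defines a linear functional on $\mathbb{P}=\mathbb{C}_p[x]$, written $\langle f(t)\,|\,q(x)\rangle$, determined by linearity and $\langle f(t)\,|\,x^n\rangle=a_n$. It also acts on $\mathbb{P}$ as a differential operator by $t^kq(x)=\frac{d^kq(x)}{dx^k}$, i.e. $f(t)q(x)=\sum_{k\ge0}\frac{a_k}{k!}q^{(k)}(x)$ (a finite sum). The symbol $\int_{\mathbb{Z}_p}\cdots\int_{\mathbb{Z}_p}e^{(x_1+\cdots+x_r)t}\,d\mu_{ -1}(x_1)\cdots d\mu_{ -1}(x_r)$ ($r$ integrals) denotes the formal power series $\sum_{k\ge0}\left(\int_{\mathbb{Z}_p}\cdots\int_{\mathbb{Z}_p}(x_1+\cdots+x_r)^k\,d\mu_{ -1}(x_1)\cdots d\mu_{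 -1}(x_r)\right)\frac{t^k}{k!}\in\mathcal{F}$. Quotients such as $\frac{2}{e^t+1}$, with $e^t=\sum_{k\ge0}t^k/k!$, are taken in the ring of formal power series. The Euler polynomials of order $r$ are defined by $\left(\frac{2}{e^t+1}\right)^re^{xt}=\sum_{n\ge0}E_n^{(r)}(x)\frac{t^n}{n!}$. Sheffer and Appell sequences: let $f(t),g(t)\in\mathcal{F}$, where $f(t)$ has order $1$ (zero constant term, nonzero coefficient of $t$) and $g(t)$ has nonzero constant term (is invertible). The Sheffer sequence for $(g(t),f(t))$, written $s_n(x)\sim(g(t),f(t))$, is the unique sequence of polynomials $s_n(x)\in\mathbb{P}$ with $\deg s_n=n$ such that $\langle g(t)f(t)^k\,|\,s_n(x)\rangle=n!\,\delta_{n,k}$ for all $n,k\ge0$. When $f(t)=t$ it is called the Appell sequence for $g(t)$. -}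

module Defs where

open import Algebra.Apartness.Bundles using (HeytingField; HeytingCommutativeRing)
open import Algebra.Apartness.Properties.HeytingCommutativeRing
  using (1#0; #-congʳ; x#0y#0→xy#0; invertibleʳ⇒#; x-0≈x)
open import Algebra.Bundles using (CommutativeRing)
open import Algebra.Morphism.Structures using (module RingMorphisms)
open import Algebra.Morphism.Construct.Composition using (isRingHomomorphism)
import Algebra.Properties.CommutativeMonoid.Sum as Sum
import Algebra.Properties.Semiring.Exp as Exp
import Algebra.Properties.Semiring.Mult as Mult
open import Data.Empty using (⊥-elim)
open import Data.Fin.Base using (toℕ)
open import Data.Integer.Base as ℤ using (ℤ; +_)
import Data.Integer.Divisibility as ℤ
open import Data.List.Base as List using (List; []; _∷_; length)
open import Data.Nat.Base as ℕ using (ℕ; zero; suc; _∸_; _!)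
open import Data.Nat.Properties using (_!≢0; _≟_)
open import Data.Product.Base using (Σ-syntax; ∃-syntax; _×_; _,_; proj₁; proj₂)
open import Data.Rational.Base as ℚ using (ℚ; 0ℚ; 1ℚ; _/_)
import Data.Rational.Properties as ℚ
open import Data.Vec.Base as Vec using (Vec; []; _∷_)
open import Function.Base using (_∘_)
import Relation.Binary.Reasoning.Setoid as ≈-Reasoning
open import Level using (Level; _⊔_; 0ℓ) renaming (suc to lsuc)
open import Relation.Binary.PropositionalEquality as ≡ using (_≡_; module ≡-Reasoning)
open import Relation.Nullary using (¬_; yes; no)

private variable
  c ℓ₁ ℓ₂ c′ ℓ₁′ ℓ₂′ : Level

ring : HeytingField c ℓ₁ ℓ₂ → CommutativeRing c ℓ₁
ring F = HeytingCommutativeRing.commutativeRing (HeytingField.heytingCommutativeRing F)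

module FieldOps (F : HeytingField c ℓ₁ ℓ₂) where
  open CommutativeRing (ring F) public
  open HeytingField F public
    using (_#_; #-irrefl; #-sym; #-cotrans; #⇒invertible; tight)
  open Exp semiring public using (_^_)
  open Mult semiring public using () renaming (_×_ to _ℕ·_)
  open Sum +-commutativeMonoid public using (sum; sum-syntax; sum⁺-syntax)

  -- The inverse of x - 0#, which is x up to _≈_.
  inv : ∀ {x} → x # 0# → Carrier
  inv x#0 = proj₁ (#⇒invertible x#0)

-- Polynomials, as lists of coefficients in increasing degree.  Trailing
-- zeros are allowed, so polynomials are compared by _≋_.

module Polynomials (F : HeytingField c ℓ₁ ℓ₂) where
  open FieldOps F

  Poly : Set c
  Poly = List Carrier

  coeff : Poly → ℕ → Carrier
  coeff []      _       = 0#
  coeff (a ∷ _) zero    = a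
  coeff (_ ∷ q) (suc i) = coeff q i

  infix 4 _≋_
  _≋_ : Poly → Poly → Set ℓ₁
  q ≋ q′ = ∀ i → coeff q i ≈ coeff q′ i

  HasDegree : Poly → ℕ → Set (ℓ₁ ⊔ ℓ₂)
  HasDegree q n = coeff q n # 0# × (∀ m → n ℕ.< m → coeff q m ≈ 0#)

  ⟦_⟧ : Poly → Carrier → Carrier
  ⟦ []    ⟧ x = 0#
  ⟦ a ∷ q ⟧ x = a + x * ⟦ q ⟧ x

  infixl 6 _⊕_
  _⊕_ : Poly → Poly → Poly
  []      ⊕ q′       = q′
  (a ∷ q) ⊕ []       = a ∷ q
  (a ∷ q) ⊕ (b ∷ q′) = (a + b) ∷ (q ⊕ q′)

  infixr 7 _•_
  _•_ : Carrier → Poly → Poly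
  a • q = List.map (a *_) q

  -- ⨁ n q = q 0 ⊕ … ⊕ q (n - 1)
  ⨁ : ℕ → (ℕ → Poly) → Poly
  ⨁ zero    q = []
  ⨁ (suc n) q = ⨁ n q ⊕ q n

  X^ : ℕ → Poly
  X^ zero    = 1# ∷ []
  X^ (suc n) = 0# ∷ X^ n

  deriv : Poly → Poly
  deriv []      = []
  deriv (_ ∷ q) = go 1 q
    where
    go : ℕ → Poly → Poly
    go n []      = []
    go n (a ∷ q) = (n ℕ· a) ∷ go (suc n) q

  deriv^ : ℕ → Poly → Poly
  deriv^ zero    q = q
  deriv^ (suc k) q = deriv (deriv^ k q)

AlgebraicallyClosed : HeytingField c ℓ₁ ℓ₂ → Set (c ⊔ ℓ₁ ⊔ ℓ₂)
AlgebraicallyClosed F = ∀ q n → HasDegree q (suc n) → ∃[ x ] ⟦ q ⟧ x ≈ 0#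
  where
  open FieldOps F
  open Polynomials F

-- Rank one valuations, written additively: |x| = p^(- v x).  Only nonzero
-- elements have a valuation in ℚ; v 0 = ∞ is built into _≤v_.

ℚ-field : HeytingField 0ℓ 0ℓ 0ℓ
ℚ-field = ℚ.heytingField

record Valuation (F : HeytingField c ℓ₁ ℓ₂) : Set (c ⊔ ℓ₁ ⊔ ℓ₂) where
  open FieldOps F
  field
    v      : ∀ {x} → x # 0# → ℚ
    v-cong : ∀ {x y} (x#0 : x # 0#) (y#0 : y # 0#) → x ≈ y → v x#0 ≡ v y#0
    v-*    : ∀ {x y} (x#0 : x # 0#) (y#0 : y # 0#) (xy#0 : x * y # 0#) →
             v xy#0 ≡ v x#0 ℚ.+ v y#0
    v-+    : ∀ {x y} (x#0 : x # 0#) (y#0 : y # 0#) (x+y#0 : x + y # 0#) →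
             v x#0 ℚ.⊓ v y#0 ℚ.≤ v x+y#0

  infix 4 _≤v_
  _≤v_ : ℚ → Carrier → Set ℓ₂
  q ≤v x = (x#0 : x # 0#) → q ℚ.≤ v x#0

  infix 4 _⟶_
  _⟶_ : (ℕ → Carrier) → Carrier → Set ℓ₂
  s ⟶ L = ∀ q → ∃[ N ] (∀ n → N ℕ.≤ n → q ≤v s n - L)

  Cauchy : (ℕ → Carrier) → Set ℓ₂
  Cauchy s = ∀ q → ∃[ N ] (∀ m n → N ℕ.≤ m → N ℕ.≤ n → q ≤v s m - s n)

  Complete : Set (c ⊔ ℓ₂)
  Complete = ∀ s → Cauchy s → ∃[ L ] s ⟶ L

  ≤v-0 : ∀ {q x} → x ≈ 0# → q ≤v x
  ≤v-0 x≈0 x#0 = ⊥-elim (#-irrefl x≈0 x#0)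

  -- Whether x # 0# holds is not decided in general, but _≤_ on ℚ is stable.
  ≤v-+ : ∀ {q x y} → q ≤v x → q ≤v y → q ≤v x + y
  ≤v-+ {q} {x} {y} q≤x q≤y x+y#0 with q ℚ.≤? v x+y#0
  ... | yes q≤ = q≤
  ... | no  q≰ = ⊥-elim (¬x#0 λ x#0 → ¬y#0 λ y#0 →
                   q≰ (ℚ.≤-trans (ℚ.⊓-glb (q≤x x#0) (q≤y y#0)) (v-+ x#0 y#0 x+y#0)))
    where
    H = HeytingField.heytingCommutativeRing F
    ¬x#0 : ¬ ¬ (x # 0#)
    ¬x#0 ¬x = ¬y λ y#0 → q≰ (ℚ.≤-trans (q≤y y#0) (ℚ.≤-reflexive (v-cong y#0 x+y#0 (sym x+y≈y))))
      where
      x≈0 = proj₁ (tight x 0#) ¬x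
      x+y≈y : x + y ≈ y
      x+y≈y = trans (+-congʳ x≈0) (+-identityˡ y)
      ¬y : ¬ ¬ (y # 0#)
      ¬y ¬y#0 = ¬y#0 (#-congʳ H x+y≈y x+y#0)
    ¬y#0 : ¬ ¬ (y # 0#)
    ¬y#0 ¬y = ¬x#0 λ x#0 → q≰ (ℚ.≤-trans (q≤x x#0) (ℚ.≤-reflexive (v-cong x#0 x+y#0 (sym x+y≈x))))
      where
      y≈0 = proj₁ (tight y 0#) ¬y
      x+y≈x : x + y ≈ x
      x+y≈x = trans (+-congˡ y≈0) (+-identityʳ x)

  0≤v1 : 0ℚ ≤v 1#
  0≤v1 1#0 = ℚ.≤-reflexive (≡.sym v1≡0)
    where
    open ≡-Reasoning
    H = HeytingField.heytingCommutativeRing F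
    v1 = v 1#0
    1*1#0 = x#0y#0→xy#0 H 1#0 1#0
    v1≡v1+v1 : v1 ≡ v1 ℚ.+ v1
    v1≡v1+v1 = ≡.trans (v-cong 1#0 1*1#0 (sym (*-identityˡ 1#))) (v-* 1#0 1#0 1*1#0)
    v1≡0 : v1 ≡ 0ℚ
    v1≡0 = begin
      v1                         ≡⟨ ℚ.+-identityʳ v1 ⟨
      v1 ℚ.+ 0ℚ                  ≡⟨ ≡.cong (v1 ℚ.+_) (ℚ.+-inverseʳ v1) ⟨
      v1 ℚ.+ (v1 ℚ.- v1)         ≡⟨ ℚ.+-assoc v1 v1 (ℚ.- v1) ⟨
      (v1 ℚ.+ v1) ℚ.- v1         ≡⟨ ≡.cong (ℚ._- v1) v1≡v1+v1 ⟨
      v1 ℚ.- v1                  ≡⟨ ℚ.+-inverseʳ v1 ⟩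
      0ℚ                         ∎

  0≤vℕ : ∀ n → 0ℚ ≤v n ℕ· 1#
  0≤vℕ zero    = ≤v-0 refl
  0≤vℕ (suc n) = ≤v-+ 0≤v1 (0≤vℕ n)

record ValuedField c ℓ₁ ℓ₂ : Set (lsuc (c ⊔ ℓ₁ ⊔ ℓ₂)) where
  field
    heytingField : HeytingField c ℓ₁ ℓ₂
    valuation    : Valuation heytingField
  open FieldOps heytingField public
  open Valuation valuation public

module _ (K : HeytingField c ℓ₁ ℓ₂) (L : HeytingField c′ ℓ₁′ ℓ₂′) where
  private
    module K = FieldOps K
    module L = FieldOps L

  -- Between fields, ring homomorphisms automatically preserve _#_.
  IsFieldHom : (K.Carrier → L.Carrier) → Set (c ⊔ ℓ₁ ⊔ ℓ₁′)
  IsFieldHom = RingMorphisms.IsRingHomomorphism K.rawRing L.rawRing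

module _ (K : ValuedField c ℓ₁ ℓ₂) (L : ValuedField c′ ℓ₁′ ℓ₂′) where
  private
    module K = ValuedField K
    module L = ValuedField L

  record ValuedExtension : Set (c ⊔ ℓ₁ ⊔ ℓ₂ ⊔ c′ ⊔ ℓ₁′ ⊔ ℓ₂′) where
    field
      embed      : K.Carrier → L.Carrier
      isFieldHom : IsFieldHom K.heytingField L.heytingField embed
      v-extends  : ∀ {x} (x#0 : x K.# K.0#) (ex#0 : embed x L.# L.0#) →
                   L.v ex#0 ≡ K.v x#0

  record Completion : Set (c ⊔ ℓ₁ ⊔ ℓ₂ ⊔ c′ ⊔ ℓ₁′ ⊔ ℓ₂′) where
    field
      extension : ValuedExtension
    open ValuedExtension extension public
    field
      dense    : ∀ y q → ∃[ x ] q L.≤v (y L.- embed x)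
      complete : L.Complete

  record AlgebraicClosure : Set (c ⊔ ℓ₁ ⊔ ℓ₂ ⊔ c′ ⊔ ℓ₁′ ⊔ ℓ₂′) where
    open Polynomials using (HasDegree; ⟦_⟧)
    field
      extension : ValuedExtension
    open ValuedExtension extension public
    field
      algebraic : ∀ y → ∃[ q ] ∃[ n ] HasDegree K.heytingField q n ×
                  ⟦_⟧ L.heytingField (List.map embed q) y L.≈ L.0#
      closed    : AlgebraicallyClosed L.heytingField

-- ℚ ⊂ ℚₚ ⊂ ℚ̄ₚ ⊂ ℂₚ.  Each field of the tower is determined by the previous
-- one up to isomorphism, and the valuation of ℚₚ has a unique extension to
-- its algebraic closure.

ℤ→ℚ : ℤ → ℚ
ℤ→ℚ a = a / 1

-- v(pᵐ a) = m for p ∤ a; this fixes v on ℚ, by multiplicativity.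
IsPadic : ℕ → Valuation ℚ-field → Set
IsPadic p V = ∀ m a → ¬ (+ p ℤ.∣ a) →
  ∀ (x#0 : ℤ→ℚ (+ (p ℕ.^ m) ℤ.* a) # 0#) → v x#0 ≡ ℤ→ℚ (+ m)
  where
  open FieldOps ℚ-field
  open Valuation V

record PadicTower (p : ℕ) (c ℓ₁ ℓ₂ : Level) : Set (lsuc (c ⊔ ℓ₁ ⊔ ℓ₂)) where
  field
    vₚ      : Valuation ℚ-field
    isPadic : IsPadic p vₚ

  ℚᵥ : ValuedField 0ℓ 0ℓ 0ℓ
  ℚᵥ = record { heytingField = ℚ-field ; valuation = vₚ }

  field
    ℚₚ ℚ̄ₚ ℂₚ : ValuedField c ℓ₁ ℓ₂
    ℚ⊂ℚₚ     : Completion ℚᵥ ℚₚ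
    ℚₚ⊂ℚ̄ₚ    : AlgebraicClosure ℚₚ ℚ̄ₚ
    ℚ̄ₚ⊂ℂₚ    : Completion ℚ̄ₚ ℂₚ

  private
    module Q  = ValuedField ℚₚ
    module C  = ValuedField ℂₚ
    module E₁ = Completion ℚ⊂ℚₚ
    module E₂ = AlgebraicClosure ℚₚ⊂ℚ̄ₚ
    module E₃ = Completion ℚ̄ₚ⊂ℂₚ

  ℚₚ→ℂₚ : Q.Carrier → C.Carrier
  ℚₚ→ℂₚ = E₃.embed ∘ E₂.embed

  ℚ→ℂₚ : ℚ → C.Carrier
  ℚ→ℂₚ = ℚₚ→ℂₚ ∘ E₁.embed

  ℚ→ℂₚ-isFieldHom : IsFieldHom ℚ-field C.heytingField ℚ→ℂₚ
  ℚ→ℂₚ-isFieldHom =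
    isRingHomomorphism C.trans
      (isRingHomomorphism (ValuedField.trans ℚ̄ₚ) E₁.isFieldHom E₂.isFieldHom)
      E₃.isFieldHom

  ℤₚ : Set (c ⊔ ℓ₂)
  ℤₚ = Σ[ a ∈ Q.Carrier ] 0ℚ Q.≤v a

  ℕ→ℤₚ : ℕ → ℤₚ
  ℕ→ℤₚ n = n Q.ℕ· Q.1# , Q.0≤vℕ n

  ℤₚ→ℂₚ : ℤₚ → C.Carrier
  ℤₚ→ℂₚ = ℚₚ→ℂₚ ∘ proj₁

module Fermionic {p : ℕ} (T : PadicTower p c ℓ₁ ℓ₂) where
  open PadicTower T
  private module Q = ValuedField ℚₚ
  open ValuedField ℂₚ

  Continuous : (ℤₚ → Carrier) → Set (c ⊔ ℓ₂)
  Continuous f = ∀ x q → ∃[ δ ] (∀ y → δ Q.≤v proj₁ y Q.- proj₁ x → q ≤v f y - f x)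

  fermionicSum : (ℤₚ → Carrier) → ℕ → Carrier
  fermionicSum f N = ∑[ x < p ℕ.^ N ] (f (ℕ→ℤₚ (toℕ x)) * (- 1#) ^ toℕ x)

  -- "∫ f dμ₋₁ exists and equals I"; I is unique up to _≈_ as _#_ is tight.
  ∫_≔_ : (ℤₚ → Carrier) → Carrier → Set (c ⊔ ℓ₂)
  ∫ f ≔ I = Continuous f × fermionicSum f ⟶ I

  -- Iterated integrals, the innermost being over the first variable.
  data ∫ⁿ : ∀ n → (Vec ℤₚ n → Carrier) → Carrier → Set (c ⊔ ℓ₁ ⊔ ℓ₂) where
    none : ∀ {f I} → f [] ≈ I → ∫ⁿ 0 f I
    step : ∀ {n f I} (g : Vec ℤₚ n → Carrier) →
           (∀ xs → ∫ (λ x → f (x ∷ xs)) ≔ g xs) → ∫ⁿ n g I → ∫ⁿ (suc n) f I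

  total : ∀ {n} → Vec ℤₚ n → Carrier
  total []       = 0#
  total (x ∷ xs) = ℤₚ→ℂₚ x + total xs

-- The homomorphism from ℚ makes F a field of characteristic zero.
module Umbral (F : HeytingField c ℓ₁ ℓ₂)
              (ℚ→F : ℚ → HeytingField.Carrier F)
              (isFieldHom : IsFieldHom ℚ-field F ℚ→F) where
  open FieldOps F
  open Polynomials F

  1/_! : ℕ → Carrier
  1/ n ! = ℚ→F (+ 1 / (n !))
    where instance _ = n !≢0

  -- f : PowerSeries stands for Σ f k tᵏ.
  PowerSeries : Set c
  PowerSeries = ℕ → Carrier

  -- Σ (a k / k!) tᵏ
  egf : (ℕ → Carrier) → PowerSeries
  egf a k = 1/ k ! * a k

  const : Carrier → PowerSeries
  const a zero    = a
  const a (suc _) = 0#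

  t : PowerSeries
  t 1 = 1#
  t _ = 0#

  infixl 6 _+ₛ_
  _+ₛ_ : PowerSeries → PowerSeries → PowerSeries
  (f +ₛ g) n = f n + g n

  infixl 7 _*ₛ_
  _*ₛ_ : PowerSeries → PowerSeries → PowerSeries
  (f *ₛ g) n = ∑[ k ≤ n ] (f (toℕ k) * g (n ∸ toℕ k))

  infixr 8 _^ₛ_
  _^ₛ_ : PowerSeries → ℕ → PowerSeries
  f ^ₛ zero  = const 1#
  f ^ₛ suc n = f *ₛ (f ^ₛ n)

  -- The coefficients n , … , 1 , 0 of 1 / f, from
  -- Σ_{k ≤ n + 1} f k · (1 / f) (n + 1 - k) = 0.
  recip-coeffs : (f : PowerSeries) → f 0 # 0# → ∀ n → Vec Carrier (suc n)
  recip-coeffs f f₀#0 zero    = inv f₀#0 ∷ []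
  recip-coeffs f f₀#0 (suc n) = - (inv f₀#0 * ∑[ k ≤ n ] (f (suc (toℕ k)) * Vec.lookup bs k)) ∷ bs
    where bs = recip-coeffs f f₀#0 n

  quotient : (f g : PowerSeries) → g 0 # 0# → PowerSeries
  quotient f g g₀#0 = f *ₛ λ n → Vec.head (recip-coeffs g g₀#0 n)

  eᵗ : PowerSeries
  eᵗ = egf λ _ → 1#

  eᵗ+1 : PowerSeries
  eᵗ+1 = eᵗ +ₛ const 1#

  eᵗ+1-invertible : eᵗ+1 0 # 0#
  eᵗ+1-invertible = invertibleʳ⇒# H (ℚ→F ℚ.½ , (begin
    (eᵗ+1 0 - 0#) * ℚ→F ℚ.½            ≈⟨ *-congʳ (x-0≈x H _) ⟩
    (ℚ→F 1ℚ * 1# + 1#) * ℚ→F ℚ.½       ≈⟨ *-congʳ (+-cong (*-identityʳ _) (sym 1#-homo)) ⟩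
    (ℚ→F 1ℚ + ℚ→F 1ℚ) * ℚ→F ℚ.½        ≈⟨ *-congʳ (+-homo 1ℚ 1ℚ) ⟨
    ℚ→F (1ℚ ℚ.+ 1ℚ) * ℚ→F ℚ.½          ≈⟨ *-homo (1ℚ ℚ.+ 1ℚ) ℚ.½ ⟨
    ℚ→F 1ℚ                             ≈⟨ 1#-homo ⟩
    1#                                 ∎))
    where
    open RingMorphisms.IsRingHomomorphism isFieldHom
    open ≈-Reasoning setoid
    H = HeytingField.heytingCommutativeRing F

  2/[eᵗ+1] : PowerSeries
  2/[eᵗ+1] = quotient (const (1# + 1#)) eᵗ+1 eᵗ+1-invertible

  -- ⟨ f ∣ xⁿ ⟩ = n! f n
  ⟨_∣_⟩ : PowerSeries → Poly → Carrier
  ⟨ f ∣ q ⟩ = ∑[ i < length q ] (coeff q (toℕ i) * ((toℕ i !) ℕ· f (toℕ i)))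

  -- f(t) q = Σ f k q⁽ᵏ⁾; the terms with k ≥ length q vanish.
  infixr 7 _▹_
  _▹_ : PowerSeries → Poly → Poly
  f ▹ q = ⨁ (length q) λ k → f k • deriv^ k q

  -- The product of f ∈ F[[t]] and h ∈ F[x][[t]] in F[x][[t]].
  infixr 7 _*ₓ_
  _*ₓ_ : PowerSeries → (ℕ → Poly) → (ℕ → Poly)
  (f *ₓ h) n = ⨁ (suc n) λ k → f k • h (n ∸ k)

  eˣᵗ : ℕ → Poly
  eˣᵗ n = 1/ n ! • X^ n

  euler : ℕ → ℕ → Poly
  euler r n = ((n !) ℕ· 1#) • ((2/[eᵗ+1] ^ₛ r) *ₓ eˣᵗ) n

  n!δ : ℕ → ℕ → Carrier
  n!δ n k with n ≟ k
  ... | yes _ = (n !) ℕ· 1#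
  ... | no  _ = 0#

  -- s n ∼ (g , f); these conditions admit exactly one s up to _≋_.
  record Sheffer (g f : PowerSeries) (s : ℕ → Poly) : Set (c ⊔ ℓ₁ ⊔ ℓ₂) where
    field
      g-invertible : g 0 # 0#
      f-const      : f 0 ≈ 0#
      f-linear     : f 1 # 0#
      degree       : ∀ n → HasDegree (s n) n
      orthogonal   : ∀ n k → ⟨ g *ₛ f ^ₛ k ∣ s n ⟩ ≈ n!δ n k

  Appell : PowerSeries → (ℕ → Poly) → Set (c ⊔ ℓ₁ ⊔ ℓ₂)
  Appell g = Sheffer g t

{-# OPTIONS --safe #-}

-- Record a polynomial q of degree at most n by its derivatives at 0, listed from
-- the n-th down, as a power series.  Then f(t) q corresponds to the product with
-- f, and ⟨ f ∣ q ⟩ is the n-th coefficient of such a product, so associativity of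
-- the product gives ⟨ h ∣ f(t) q ⟩ = ⟨ h f ∣ q ⟩.  Since q(x) = ⟨ eˣᵗ ∣ q ⟩, the
-- polynomial Q = 2/(eᵗ+1) q satisfies Q(x + 1) + Q(x) = 2 q(x).  Hence the sum of
-- (-1)ᵏ q(k + s) over k < pᴺ telescopes to (Q(s) + Q(s + pᴺ)) / 2, as pᴺ is odd,
-- and it tends to Q(s) because polynomials are continuous and pᴺ tends to 0.
-- Iterating gives the r-fold integral; its k-th moment is k! times the coefficient
-- of tᵏ in (2/(eᵗ+1))ʳ, and the Appell property is the adjunction above.

module Submission where

open import Defs
open import Algebra.Apartness.Bundles using (HeytingField)
open import Algebra.Apartness.Properties.HeytingCommutativeRing
  using (x-0≈x; 1#0; #-congʳ; x#0y#0→xy#0; invertibleʳ⇒#)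
open import Algebra.Bundles using (CommutativeRing)
open import Algebra.Morphism.Construct.Composition using (isRingHomomorphism)
open import Algebra.Morphism.Structures using (module RingMorphisms)
import Algebra.Properties.CommutativeSemiring.Binomial as Binomial
import Algebra.Properties.Ring as Ring
import Algebra.Properties.Semiring.Exp as Exp
import Algebra.Properties.Semiring.Mult as Mult
import Algebra.Properties.Semiring.Sum as Sum
import Algebra.Solver.Ring.NaturalCoefficients.Default as SemiringSolver
open import Data.Empty using (⊥-elim)
open import Data.Fin.Base using (Fin; zero; suc; toℕ)
open import Data.Fin.Properties using (toℕ<n)
open import Data.Integer.Base as ℤ using (+_; -[1+_])
import Data.Integer.Properties as ℤ
open import Data.Integer.Tactic.RingSolver using (solve-∀)
open import Data.List.Base using ([]; _∷_; length)
open import Data.Nat.Base as ℕ using (ℕ; zero; suc; _∸_; _≤_; _<_; z≤n; s≤s; _!)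
open import Data.Nat.Combinatorics using (_C_; nCk≡n!/k![n-k]!; k![n∸k]!∣n!)
open import Data.Nat.Divisibility using (_∣_; divides; ∣1⇒≡1)
open import Data.Nat.DivMod using (m/n*n≡m)
open import Data.Nat.Primality using (Prime; prime⇒irreducible; ¬prime[1])
import Data.Nat.Properties as ℕ
open import Data.Product.Base using (Σ-syntax; ∃-syntax; _×_; _,_; proj₁; proj₂)
open import Data.Rational.Base as ℚ using (ℚ)
import Data.Rational.Properties as ℚ
import Data.Rational.Unnormalised.Base as ℚᵘ
import Data.Rational.Unnormalised.Properties as ℚᵘ
open import Data.Sum.Base using (inj₁; inj₂)
open import Data.Vec.Base as Vec using (lookup; _∷_)
import Relation.Binary.Reasoning.Setoid as ≈-Reasoning
open import Relation.Binary.PropositionalEquality as ≡ using (_≡_; _≢_)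
open import Relation.Nullary using (¬_; yes; no)

-- Finite sums over initial segments of the natural numbers

module FiniteSums {c ℓ₁ ℓ₂} (F : HeytingField c ℓ₁ ℓ₂) where
  open FieldOps F
  open Sum semiring public using (sum-cong-≋; ∑-distrib-+; *-distribˡ-sum)
  open ≈-Reasoning setoid

  ∑-cong : ∀ n {f g : ℕ → Carrier} → (∀ k → k < n → f k ≈ g k) →
           ∑[ k < n ] f (toℕ k) ≈ ∑[ k < n ] g (toℕ k)
  ∑-cong n f≈g = sum-cong-≋ λ k → f≈g (toℕ k) (toℕ<n k)

  ∑-zero : ∀ n {f : ℕ → Carrier} → (∀ k → f k ≈ 0#) → ∑[ k < n ] f (toℕ k) ≈ 0#
  ∑-zero zero    f≈0 = refl
  ∑-zero (suc n) f≈0 = trans (+-cong (f≈0 0) (∑-zero n (λ k → f≈0 (suc k)))) (+-identityˡ 0#)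

  ∑-snoc : ∀ n (f : ℕ → Carrier) → ∑[ k ≤ n ] f (toℕ k) ≈ ∑[ k < n ] f (toℕ k) + f n
  ∑-snoc zero    f = +-comm (f 0) 0#
  ∑-snoc (suc n) f = begin
    f 0 + ∑[ k ≤ n ] f (suc (toℕ k))                ≈⟨ +-congˡ (∑-snoc n (λ k → f (suc k))) ⟩
    f 0 + (∑[ k < n ] f (suc (toℕ k)) + f (suc n))  ≈⟨ +-assoc _ _ _ ⟨
    ∑[ k ≤ n ] f (toℕ k) + f (suc n)                ∎

  ∑-truncate : ∀ {m n} {f : ℕ → Carrier} → m ≤ n → (∀ k → m ≤ k → f k ≈ 0#) →
               ∑[ k < n ] f (toℕ k) ≈ ∑[ k < m ] f (toℕ k)
  ∑-truncate {n = n} z≤n f≈0 = ∑-zero n (λ k → f≈0 k z≤n)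
  ∑-truncate (s≤s m≤n)   f≈0 = +-congˡ (∑-truncate m≤n λ k m≤k → f≈0 (suc k) (s≤s m≤k))

  -- Both ranges contain every nonzero term. This trades the length of a coefficient list for a
  -- degree bound as the range of summation.
  ∑-range : ∀ m n {f : ℕ → Carrier} → (∀ k → m ≤ k → f k ≈ 0#) → (∀ k → n ≤ k → f k ≈ 0#) →
            ∑[ k < m ] f (toℕ k) ≈ ∑[ k < n ] f (toℕ k)
  ∑-range m n f≈0 f≈0′ with ℕ.≤-total m n
  ... | inj₁ m≤n = sym (∑-truncate m≤n f≈0)
  ... | inj₂ n≤m = ∑-truncate n≤m f≈0′

-- The ring of formal power series, with reciprocals

module PowerSeriesAlgebra {c ℓ₁ ℓ₂} (F : HeytingField c ℓ₁ ℓ₂)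
         (ℚ→F : ℚ → HeytingField.Carrier F) (isFieldHom : IsFieldHom ℚ-field F ℚ→F) where
  open FieldOps F
  open Umbral F ℚ→F isFieldHom
  open FiniteSums F
  open SemiringSolver commutativeSemiring using (solve; _:+_; _:*_; _:=_; con)
  open ≈-Reasoning setoid

  infix 4 _≈ₛ_
  _≈ₛ_ : PowerSeries → PowerSeries → Set ℓ₁
  f ≈ₛ g = ∀ n → f n ≈ g n

  -- A coefficient of a product depends only on coefficients of lower or equal index. The bound
  -- matters for `reversed-▹`, which holds only up to the chosen degree.
  *ₛ-cong-≤ : ∀ {f f′ g g′} n → (∀ k → k ≤ n → f k ≈ f′ k) → (∀ k → k ≤ n → g k ≈ g′ k) →
              (f *ₛ g) n ≈ (f′ *ₛ g′) n
  *ₛ-cong-≤ {f} {f′} {g} {g′} n f≈f′ g≈g′ =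
    ∑-cong (suc n) {λ k → f k * g (n ∸ k)} {λ k → f′ k * g′ (n ∸ k)}
      λ k k≤n → *-cong (f≈f′ k (ℕ.s≤s⁻¹ k≤n)) (g≈g′ (n ∸ k) (ℕ.m∸n≤m n k))

  *ₛ-cong : ∀ {f f′ g g′} → f ≈ₛ f′ → g ≈ₛ g′ → f *ₛ g ≈ₛ f′ *ₛ g′
  *ₛ-cong f≈f′ g≈g′ n = *ₛ-cong-≤ n (λ k _ → f≈f′ k) (λ k _ → g≈g′ k)

  *ₛ-distribʳ : ∀ f g h → (f +ₛ g) *ₛ h ≈ₛ f *ₛ h +ₛ g *ₛ h
  *ₛ-distribʳ f g h n = trans
    (sum-cong-≋ {suc n} λ k → distribʳ (h (n ∸ toℕ k)) (f (toℕ k)) (g (toℕ k)))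
    (∑-distrib-+ {suc n} (λ k → f (toℕ k) * h (n ∸ toℕ k)) (λ k → g (toℕ k) * h (n ∸ toℕ k)))

  *ₛ-scaleˡ : ∀ a f g → (λ n → a * f n) *ₛ g ≈ₛ λ n → a * (f *ₛ g) n
  *ₛ-scaleˡ a f g n = trans
    (sum-cong-≋ {suc n} λ k → *-assoc a (f (toℕ k)) (g (n ∸ toℕ k)))
    (sym (*-distribˡ-sum {suc n} a (λ k → f (toℕ k) * g (n ∸ toℕ k))))

  -- The product unfolds at the constant term of `f`; splitting off the other end of the sum instead
  -- is what the induction for `*ₛ-comm` needs.
  *ₛ-snoc : ∀ f g n → (f *ₛ g) (suc n) ≈ (f *ₛ λ k → g (suc k)) n + f (suc n) * g 0
  *ₛ-snoc f g zero    = solve 4 (λ a b c d → a :* b :+ (c :* d :+ con 0) := (a :* b :+ con 0) :+ c :* d)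
                          refl (f 0) (g 1) (f 1) (g 0)
  *ₛ-snoc f g (suc n) = trans (+-congˡ (*ₛ-snoc (λ k → f (suc k)) g n)) (sym (+-assoc _ _ _))

  *ₛ-comm : ∀ f g → f *ₛ g ≈ₛ g *ₛ f
  *ₛ-comm f g zero    = +-congʳ (*-comm (f 0) (g 0))
  *ₛ-comm f g (suc n) = begin
    f 0 * g (suc n) + ((λ k → f (suc k)) *ₛ g) n  ≈⟨ +-cong (*-comm _ _) (*ₛ-comm (λ k → f (suc k)) g n) ⟩
    g (suc n) * f 0 + (g *ₛ λ k → f (suc k)) n    ≈⟨ +-comm _ _ ⟩
    (g *ₛ λ k → f (suc k)) n + g (suc n) * f 0    ≈⟨ *ₛ-snoc g f n ⟨
    (g *ₛ f) (suc n)                              ∎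

  -- Induction on the index: the tail of `f *ₛ g` is `f 0` times the tail of `g`, plus the tail of
  -- `f` times `g`, and multiplication by `h` distributes over this sum.
  *ₛ-assoc : ∀ f g h → (f *ₛ g) *ₛ h ≈ₛ f *ₛ (g *ₛ h)
  *ₛ-assoc f g h zero = solve 3 (λ a b c → (a :* b :+ con 0) :* c :+ con 0 := a :* (b :* c :+ con 0) :+ con 0)
                          refl (f 0) (g 0) (h 0)
  *ₛ-assoc f g h (suc n) = begin
    (f₀ * g 0 + 0#) * hₙ + ((λ k → f₀ * g⁺ k + (f⁺ *ₛ g) k) *ₛ h) n
      ≈⟨ +-cong (*-congʳ (+-identityʳ _)) (*ₛ-distribʳ (λ k → f₀ * g⁺ k) (f⁺ *ₛ g) h n) ⟩
    f₀ * g 0 * hₙ + (((λ k → f₀ * g⁺ k) *ₛ h) n + ((f⁺ *ₛ g) *ₛ h) n)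
      ≈⟨ +-congˡ (+-cong (*ₛ-scaleˡ f₀ g⁺ h n) (*ₛ-assoc f⁺ g h n)) ⟩
    f₀ * g 0 * hₙ + (f₀ * (g⁺ *ₛ h) n + (f⁺ *ₛ (g *ₛ h)) n)
      ≈⟨ solve 5 (λ a b c d e → a :* b :* c :+ (a :* d :+ e) := a :* (b :* c :+ d) :+ e)
           refl f₀ (g 0) hₙ ((g⁺ *ₛ h) n) ((f⁺ *ₛ (g *ₛ h)) n) ⟩
    f₀ * (g 0 * hₙ + (g⁺ *ₛ h) n) + (f⁺ *ₛ (g *ₛ h)) n ∎
    where
    f₀ = f 0
    hₙ = h (suc n)
    f⁺ g⁺ : PowerSeries
    f⁺ k = f (suc k)
    g⁺ k = g (suc k)

  const-*ₛ : ∀ a f → const a *ₛ f ≈ₛ λ n → a * f n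
  const-*ₛ a f zero    = +-identityʳ _
  const-*ₛ a f (suc n) = trans (+-congˡ (∑-zero (suc n) {λ k → 0# * f (n ∸ k)} λ k → zeroˡ _)) (+-identityʳ _)

  *ₛ-identityˡ : ∀ f → const 1# *ₛ f ≈ₛ f
  *ₛ-identityˡ f n = trans (const-*ₛ 1# f n) (*-identityˡ (f n))

  *ₛ-swapʳ : ∀ f g h → (f *ₛ g) *ₛ h ≈ₛ (f *ₛ h) *ₛ g
  *ₛ-swapʳ f g h n = begin
    ((f *ₛ g) *ₛ h) n  ≈⟨ *ₛ-assoc f g h n ⟩
    (f *ₛ (g *ₛ h)) n  ≈⟨ *ₛ-cong {f} (λ _ → refl) (*ₛ-comm g h) n ⟩
    (f *ₛ (h *ₛ g)) n  ≈⟨ *ₛ-assoc f h g n ⟨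
    ((f *ₛ h) *ₛ g) n  ∎

  inv-inverse : ∀ {x} (x#0 : x # 0#) → x * inv x#0 ≈ 1#
  inv-inverse {x} x#0 = trans (*-congʳ (sym (x-0≈x H x))) (proj₂ (proj₂ (#⇒invertible x#0)))
    where H = HeytingField.heytingCommutativeRing F

  recip : (g : PowerSeries) → g 0 # 0# → PowerSeries
  recip g g₀#0 n = Vec.head (recip-coeffs g g₀#0 n)

  -- The vector lists coefficients downwards and its own tail is the previous vector; hence the sum
  -- in its recursion is a convolution with `recip`.
  lookup-recip-coeffs : ∀ g (g₀#0 : g 0 # 0#) n (k : Fin (suc n)) →
                        lookup (recip-coeffs g g₀#0 n) k ≡ recip g g₀#0 (n ∸ toℕ k)
  lookup-recip-coeffs g g₀#0 zero    zero    = ≡.refl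
  lookup-recip-coeffs g g₀#0 (suc n) zero    = ≡.refl
  lookup-recip-coeffs g g₀#0 (suc n) (suc k) = lookup-recip-coeffs g g₀#0 n k

  -- Each new coefficient is chosen so that its product with `g 0` is minus the rest `S` of the
  -- convolution.
  *ₛ-recip : ∀ g (g₀#0 : g 0 # 0#) → g *ₛ recip g g₀#0 ≈ₛ const 1#
  *ₛ-recip g g₀#0 zero    = trans (+-identityʳ _) (inv-inverse g₀#0)
  *ₛ-recip g g₀#0 (suc n) = begin
    g 0 * - (inv g₀#0 * S) + S′   ≈⟨ +-cong (trans (sym (-‿distribʳ-* _ _)) (-‿cong g₀*inv)) S′≈S ⟩
    - S + S                       ≈⟨ -‿inverseˡ S ⟩
    0#                            ∎
    where
    open Ring (CommutativeRing.ring (Defs.ring F)) using (-‿distribʳ-*)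
    S  = ∑[ k ≤ n ] (g (suc (toℕ k)) * lookup (recip-coeffs g g₀#0 n) k)
    S′ = ((λ k → g (suc k)) *ₛ recip g g₀#0) n
    S′≈S : S′ ≈ S
    S′≈S = sum-cong-≋ {suc n} λ k → *-congˡ {g (suc (toℕ k))} (reflexive (≡.sym (lookup-recip-coeffs g g₀#0 n k)))
    g₀*inv : g 0 * (inv g₀#0 * S) ≈ S
    g₀*inv = trans (sym (*-assoc _ _ _)) (trans (*-congʳ (inv-inverse g₀#0)) (*-identityˡ S))

  quotient-*ₛ : ∀ f g (g₀#0 : g 0 # 0#) → quotient f g g₀#0 *ₛ g ≈ₛ f
  quotient-*ₛ f g g₀#0 n = begin
    ((f *ₛ recip g g₀#0) *ₛ g) n  ≈⟨ *ₛ-assoc f (recip g g₀#0) g n ⟩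
    (f *ₛ (recip g g₀#0 *ₛ g)) n  ≈⟨ *ₛ-cong {f} (λ _ → refl) (λ k → trans (*ₛ-comm (recip g g₀#0) g k) (*ₛ-recip g g₀#0 k)) n ⟩
    (f *ₛ const 1#) n             ≈⟨ *ₛ-comm f (const 1#) n ⟩
    (const 1# *ₛ f) n             ≈⟨ *ₛ-identityˡ f n ⟩
    f n                           ∎

  -- Serves the Appell property, where the denominator is the series of moments and `h` is a power
  -- of `2/[eᵗ+1]`, equal to it only coefficientwise.
  quotient-*ₛ-cong : ∀ f {g h} (g₀#0 : g 0 # 0#) → g ≈ₛ h → quotient f g g₀#0 *ₛ h ≈ₛ f
  quotient-*ₛ-cong f {g} {h} g₀#0 g≈h n = trans
    (*ₛ-cong {quotient f g g₀#0} {g = h} {g} (λ _ → refl) (λ k → sym (g≈h k)) n) (quotient-*ₛ f g g₀#0 n)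

-- Rational and factorial arithmetic

-- Normalised fractions do not compute on a variable `n`; passing to unnormalised ones leaves an
-- identity of integers.
ℤ→ℚ-suc : ∀ n → ℤ→ℚ (+ suc n) ≡ ℚ.1ℚ ℚ.+ ℤ→ℚ (+ n)
ℤ→ℚ-suc n = ℚ.toℚᵘ-injective (begin
  ℚ.toℚᵘ (ℤ→ℚ (+ suc n))              ≈⟨ ℚ.toℚᵘ-fromℚᵘ (ℚᵘ.mkℚᵘ (+ suc n) 0) ⟩
  ℚᵘ.mkℚᵘ (+ suc n) 0                 ≈⟨ ℚᵘ.*≡* (lemma (+ n)) ⟩
  ℚᵘ.1ℚᵘ ℚᵘ.+ ℚᵘ.mkℚᵘ (+ n) 0         ≈⟨ ℚᵘ.+-congʳ ℚᵘ.1ℚᵘ (ℚ.toℚᵘ-fromℚᵘ (ℚᵘ.mkℚᵘ (+ n) 0)) ⟨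
  ℚᵘ.1ℚᵘ ℚᵘ.+ ℚ.toℚᵘ (ℤ→ℚ (+ n))      ≈⟨ ℚ.toℚᵘ-homo-+ ℚ.1ℚ (ℤ→ℚ (+ n)) ⟨
  ℚ.toℚᵘ (ℚ.1ℚ ℚ.+ ℤ→ℚ (+ n))         ∎)
  where
  open ≈-Reasoning ℚᵘ.≃-setoid
  lemma : ∀ i → (+ 1 ℤ.+ i) ℤ.* + 1 ≡ (+ 1 ℤ.* + 1 ℤ.+ i ℤ.* + 1) ℤ.* + 1
  lemma = solve-∀

1/n*n≡1 : ∀ n .{{_ : ℕ.NonZero n}} → (+ 1 ℚ./ n) ℚ.* ℤ→ℚ (+ n) ≡ ℚ.1ℚ
1/n*n≡1 n@(suc n-1) = ℚ.toℚᵘ-injective (begin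
  ℚ.toℚᵘ ((+ 1 ℚ./ n) ℚ.* ℤ→ℚ (+ n))             ≈⟨ ℚ.toℚᵘ-homo-* (+ 1 ℚ./ n) (ℤ→ℚ (+ n)) ⟩
  ℚ.toℚᵘ (+ 1 ℚ./ n) ℚᵘ.* ℚ.toℚᵘ (ℤ→ℚ (+ n))     ≈⟨ ℚᵘ.*-cong (ℚ.toℚᵘ-fromℚᵘ (ℚᵘ.mkℚᵘ (+ 1) n-1))
                                                              (ℚ.toℚᵘ-fromℚᵘ (ℚᵘ.mkℚᵘ (+ n) 0)) ⟩
  ℚᵘ.mkℚᵘ (+ 1) n-1 ℚᵘ.* ℚᵘ.mkℚᵘ (+ n) 0         ≈⟨ ℚᵘ.*≡* (lemma (+ n)) ⟩
  ℚᵘ.1ℚᵘ                                         ∎)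
  where
  open ≈-Reasoning ℚᵘ.≃-setoid
  lemma : ∀ i → + 1 ℤ.* i ℤ.* + 1 ≡ + 1 ℤ.* (i ℤ.* + 1)
  lemma = solve-∀

n!≡nCk*k!*[n∸k]! : ∀ {n k} → k ≤ n → n ! ≡ (n C k) ℕ.* (k ! ℕ.* (n ∸ k) !)
n!≡nCk*k!*[n∸k]! {n} {k} k≤n = ≡.sym (≡.trans
  (≡.cong (ℕ._* (k ! ℕ.* (n ∸ k) !)) (nCk≡n!/k![n-k]! k≤n))
  (m/n*n≡m (k![n∸k]!∣n! k≤n)))
  where instance _ = k ℕ.!* (n ∸ k) !≢0

-- Factorials in characteristic zero and the exponential series

module Exponential {c ℓ₁ ℓ₂} (F : HeytingField c ℓ₁ ℓ₂)
         (ℚ→F : ℚ → HeytingField.Carrier F) (isFieldHom : IsFieldHom ℚ-field F ℚ→F) where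
  open FieldOps F
  open Umbral F ℚ→F isFieldHom
  open RingMorphisms.IsRingHomomorphism isFieldHom
  open Mult semiring public
    using (×-congʳ; ×-assocˡ; ×-assoc-*; ×-comm-*; ×1-homo-*)
  open FiniteSums F
  open PowerSeriesAlgebra F ℚ→F isFieldHom
  open SemiringSolver commutativeSemiring using (solve; _:*_; _:=_; con)
  open ≈-Reasoning setoid

  ×-as-* : ∀ n x → n ℕ· x ≈ (n ℕ· 1#) * x
  ×-as-* n x = trans (×-congʳ n (sym (*-identityˡ x))) (sym (×-assoc-* n 1# x))

  ℚ→F-ℕ : ∀ n → ℚ→F (ℤ→ℚ (+ n)) ≈ n ℕ· 1#
  ℚ→F-ℕ zero    = 0#-homo
  ℚ→F-ℕ (suc n) = begin
    ℚ→F (ℤ→ℚ (+ suc n))            ≡⟨ ≡.cong ℚ→F (ℤ→ℚ-suc n) ⟩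
    ℚ→F (ℚ.1ℚ ℚ.+ ℤ→ℚ (+ n))       ≈⟨ +-homo ℚ.1ℚ (ℤ→ℚ (+ n)) ⟩
    ℚ→F ℚ.1ℚ + ℚ→F (ℤ→ℚ (+ n))     ≈⟨ +-cong 1#-homo (ℚ→F-ℕ n) ⟩
    1# + n ℕ· 1#                   ∎

  1/n!*n! : ∀ n → 1/ n ! * ((n !) ℕ· 1#) ≈ 1#
  1/n!*n! n = begin
    1/ n ! * ((n !) ℕ· 1#)                        ≈⟨ *-congˡ (ℚ→F-ℕ (n !)) ⟨
    ℚ→F (+ 1 ℚ./ (n !)) * ℚ→F (ℤ→ℚ (+ (n !)))     ≈⟨ *-homo _ _ ⟨
    ℚ→F ((+ 1 ℚ./ (n !)) ℚ.* ℤ→ℚ (+ (n !)))       ≡⟨ ≡.cong ℚ→F (1/n*n≡1 (n !)) ⟩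
    ℚ→F ℚ.1ℚ                                      ≈⟨ 1#-homo ⟩
    1#                                            ∎
    where instance _ = n ℕ.!≢0

  1/n!-× : ∀ n x → 1/ n ! * ((n !) ℕ· x) ≈ x
  1/n!-× n x = begin
    1/ n ! * ((n !) ℕ· x)          ≈⟨ *-congˡ (×-as-* (n !) x) ⟩
    1/ n ! * (((n !) ℕ· 1#) * x)   ≈⟨ *-assoc _ _ _ ⟨
    1/ n ! * ((n !) ℕ· 1#) * x     ≈⟨ *-congʳ (1/n!*n! n) ⟩
    1# * x                         ≈⟨ *-identityˡ x ⟩
    x                              ∎

  ×-1/n! : ∀ n x → (n !) ℕ· (1/ n ! * x) ≈ x
  ×-1/n! n x = trans (sym (×-comm-* (n !) (1/ n !) x)) (1/n!-× n x)

  -- Factorials are invertible in characteristic zero. Coefficients of polynomials can thus be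
  -- compared after scaling by `i !`, which makes differentiation a shift.
  !-cancel : ∀ n {x y} → (n !) ℕ· x ≈ (n !) ℕ· y → x ≈ y
  !-cancel n {x} {y} n!x≈n!y = begin
    x                      ≈⟨ 1/n!-× n x ⟨
    1/ n ! * ((n !) ℕ· x)  ≈⟨ *-congˡ n!x≈n!y ⟩
    1/ n ! * ((n !) ℕ· y)  ≈⟨ 1/n!-× n y ⟩
    y                      ∎

  nCk/n! : ∀ {n k} → k ≤ n → 1/ n ! * ((n C k) ℕ· 1#) ≈ 1/ k ! * 1/ (n ∸ k) !
  nCk/n! {n} {k} k≤n = begin
    -- Insert two factors 1, to be written as `1/ k ! * a` and `1/ (n ∸ k) ! * b`; then `a` and `b`
    -- combine with the binomial coefficient `B` to `n !`.
    1/ n ! * B                                  ≈⟨ solve 2 (λ x y → x :* y := x :* y :* con 1 :* con 1) refl (1/ n !) B ⟩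
    1/ n ! * B * 1# * 1#                        ≈⟨ *-cong (*-congˡ (sym (1/n!*n! k))) (sym (1/n!*n! (n ∸ k))) ⟩
    1/ n ! * B * (1/ k ! * a) * (1/ (n ∸ k) ! * b)
      ≈⟨ solve 6 (λ x y u a v b → x :* y :* (u :* a) :* (v :* b) := x :* (y :* (a :* b)) :* (u :* v))
           refl (1/ n !) B (1/ k !) a (1/ (n ∸ k) !) b ⟩
    1/ n ! * (B * (a * b)) * (1/ k ! * 1/ (n ∸ k) !)  ≈⟨ *-congʳ (*-congˡ B*a*b) ⟩
    1/ n ! * ((n !) ℕ· 1#) * (1/ k ! * 1/ (n ∸ k) !)  ≈⟨ *-congʳ (1/n!*n! n) ⟩
    1# * (1/ k ! * 1/ (n ∸ k) !)                      ≈⟨ *-identityˡ _ ⟩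
    1/ k ! * 1/ (n ∸ k) !                             ∎
    where
    B = (n C k) ℕ· 1#
    a = (k !) ℕ· 1#
    b = ((n ∸ k) !) ℕ· 1#
    B*a*b : B * (a * b) ≈ (n !) ℕ· 1#
    B*a*b = begin
      B * (a * b)                                        ≈⟨ *-congˡ (×1-homo-* (k !) ((n ∸ k) !)) ⟨
      B * ((k ! ℕ.* (n ∸ k) !) ℕ· 1#)                    ≈⟨ ×1-homo-* (n C k) (k ! ℕ.* (n ∸ k) !) ⟨
      ((n C k) ℕ.* (k ! ℕ.* (n ∸ k) !)) ℕ· 1#            ≡⟨ ≡.cong (_ℕ· 1#) (n!≡nCk*k!*[n∸k]! k≤n) ⟨
      (n !) ℕ· 1#                                        ∎

  exp : Carrier → PowerSeries
  exp x = egf (x ^_)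

  -- The binomial theorem divided by `n !`, with `nCk/n!` distributing the factorials over the two
  -- factors.
  exp-+ : ∀ x y → exp (x + y) ≈ₛ exp x *ₛ exp y
  exp-+ x y n = begin
    1/ n ! * (x + y) ^ n
      ≈⟨ *-congˡ (Binomial.theorem commutativeSemiring n x y) ⟩
    1/ n ! * ∑[ k ≤ n ] ((n C toℕ k) ℕ· (x ^ toℕ k * y ^ (n ∸ toℕ k)))
      ≈⟨ *-distribˡ-sum {suc n} (1/ n !) (λ k → (n C toℕ k) ℕ· (x ^ toℕ k * y ^ (n ∸ toℕ k))) ⟩
    ∑[ k ≤ n ] (1/ n ! * ((n C toℕ k) ℕ· (x ^ toℕ k * y ^ (n ∸ toℕ k))))
      ≈⟨ ∑-cong (suc n) {λ k → 1/ n ! * ((n C k) ℕ· (x ^ k * y ^ (n ∸ k)))}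
           (λ k k≤n → term k (ℕ.s≤s⁻¹ k≤n)) ⟩
    (exp x *ₛ exp y) n ∎
    where
    term : ∀ k → k ≤ n → 1/ n ! * ((n C k) ℕ· (x ^ k * y ^ (n ∸ k))) ≈ exp x k * exp y (n ∸ k)
    term k k≤n = begin
      1/ n ! * ((n C k) ℕ· z)                           ≈⟨ *-congˡ (×-as-* (n C k) z) ⟩
      1/ n ! * (((n C k) ℕ· 1#) * z)                    ≈⟨ *-assoc _ _ _ ⟨
      1/ n ! * ((n C k) ℕ· 1#) * z                      ≈⟨ *-congʳ (nCk/n! k≤n) ⟩
      1/ k ! * 1/ (n ∸ k) ! * (x ^ k * y ^ (n ∸ k))
        ≈⟨ solve 4 (λ a b c d → a :* b :* (c :* d) := a :* c :* (b :* d)) refl (1/ k !) (1/ (n ∸ k) !) (x ^ k) (y ^ (n ∸ k)) ⟩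
      exp x k * exp y (n ∸ k)                           ∎
      where z = x ^ k * y ^ (n ∸ k)

  1^n≈1 : ∀ n → 1# ^ n ≈ 1#
  1^n≈1 zero    = refl
  1^n≈1 (suc n) = trans (*-identityˡ _) (1^n≈1 n)

  exp-1 : exp 1# ≈ₛ eᵗ
  exp-1 n = *-congˡ (1^n≈1 n)

  exp-0 : exp 0# ≈ₛ const 1#
  exp-0 zero    = trans (*-identityʳ _) 1#-homo
  exp-0 (suc n) = trans (*-congˡ (zeroˡ _)) (zeroʳ _)

-- Coefficients, derivatives and degrees of polynomials

module PolynomialCoefficients {c ℓ₁ ℓ₂} (F : HeytingField c ℓ₁ ℓ₂) where
  open FieldOps F
  open Polynomials F
  open Mult semiring using (×-congʳ; ×-assocˡ)
  open FiniteSums F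
  open ≈-Reasoning setoid

  coeff-⊕ : ∀ q q′ i → coeff (q ⊕ q′) i ≈ coeff q i + coeff q′ i
  coeff-⊕ []      q′       i       = sym (+-identityˡ _)
  coeff-⊕ (a ∷ q) []       i       = sym (+-identityʳ _)
  coeff-⊕ (a ∷ q) (b ∷ q′) zero    = refl
  coeff-⊕ (a ∷ q) (b ∷ q′) (suc i) = coeff-⊕ q q′ i

  coeff-• : ∀ a q i → coeff (a • q) i ≈ a * coeff q i
  coeff-• a []      i       = sym (zeroʳ a)
  coeff-• a (b ∷ q) zero    = refl
  coeff-• a (b ∷ q) (suc i) = coeff-• a q i

  coeff-⨁ : ∀ n (q : ℕ → Poly) i → coeff (⨁ n q) i ≈ ∑[ k < n ] coeff (q (toℕ k)) i
  coeff-⨁ zero    q i = refl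
  coeff-⨁ (suc n) q i = begin
    coeff (⨁ n q ⊕ q n) i                            ≈⟨ coeff-⊕ (⨁ n q) (q n) i ⟩
    coeff (⨁ n q) i + coeff (q n) i                  ≈⟨ +-congʳ (coeff-⨁ n q i) ⟩
    ∑[ k < n ] coeff (q (toℕ k)) i + coeff (q n) i   ≈⟨ ∑-snoc n (λ k → coeff (q k) i) ⟨
    ∑[ k ≤ n ] coeff (q (toℕ k)) i                   ∎

  coeff-length : ∀ q i → length q ≤ i → coeff q i ≈ 0#
  coeff-length []      i       _         = refl
  coeff-length (a ∷ q) (suc i) (s≤s q≤i) = coeff-length q i q≤i

  -- A name for the local function of deriv: unification solves the
  -- underscore once the with-abstraction has turned its arguments into variables.
  mutual
    weight : Carrier → Poly → ℕ → Poly → Poly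
    weight = _

    deriv-∷∷ : ∀ a b q → deriv (a ∷ b ∷ q) ≡ (1 ℕ· b) ∷ weight a (b ∷ q) 2 q
    deriv-∷∷ a b q with b ∷ q | 2
    ... | _ | _ = ≡.refl

  ×-zeroʳ : ∀ m → m ℕ· 0# ≈ 0#
  ×-zeroʳ zero    = refl
  ×-zeroʳ (suc m) = trans (+-identityˡ _) (×-zeroʳ m)

  coeff-weight : ∀ a q₀ n q i → coeff (weight a q₀ n q) i ≈ (n ℕ.+ i) ℕ· coeff q i
  coeff-weight a q₀ n []      i       = sym (×-zeroʳ (n ℕ.+ i))
  coeff-weight a q₀ n (b ∷ q) zero    = reflexive (≡.cong (_ℕ· b) (≡.sym (ℕ.+-identityʳ n)))
  coeff-weight a q₀ n (b ∷ q) (suc i) = trans (coeff-weight a q₀ (suc n) q i)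
    (reflexive (≡.cong (_ℕ· coeff q i) (≡.sym (ℕ.+-suc n i))))

  coeff-deriv : ∀ q i → coeff (deriv q) i ≈ suc i ℕ· coeff q (suc i)
  coeff-deriv []      i = sym (×-zeroʳ (suc i))
  coeff-deriv (a ∷ q) i = coeff-weight a q 1 q i

  -- The `i`-th derivative of `q` at 0; in these coordinates differentiation is a shift of the
  -- index.
  taylor : Poly → ℕ → Carrier
  taylor q i = (i !) ℕ· coeff q i

  taylor-deriv^ : ∀ k q i → taylor (deriv^ k q) i ≈ taylor q (i ℕ.+ k)
  taylor-deriv^ zero    q i = reflexive (≡.cong (taylor q) (≡.sym (ℕ.+-identityʳ i)))
  taylor-deriv^ (suc k) q i = begin
    (i !) ℕ· coeff (deriv (deriv^ k q)) i            ≈⟨ ×-congʳ (i !) (coeff-deriv (deriv^ k q) i) ⟩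
    (i !) ℕ· (suc i ℕ· coeff (deriv^ k q) (suc i))   ≈⟨ ×-assocˡ _ (i !) (suc i) ⟩
    (i ! ℕ.* suc i) ℕ· coeff (deriv^ k q) (suc i)    ≡⟨ ≡.cong (_ℕ· coeff (deriv^ k q) (suc i)) (ℕ.*-comm (i !) (suc i)) ⟩
    taylor (deriv^ k q) (suc i)                      ≈⟨ taylor-deriv^ k q (suc i) ⟩
    taylor q (suc i ℕ.+ k)                           ≡⟨ ≡.cong (taylor q) (ℕ.+-suc i k) ⟨
    taylor q (i ℕ.+ suc k)                           ∎

  taylor-zero : ∀ q i → coeff q i ≈ 0# → taylor q i ≈ 0#
  taylor-zero q i qᵢ≈0 = trans (×-congʳ (i !) qᵢ≈0) (×-zeroʳ (i !))

  *-taylor-zero : ∀ a q i → coeff q i ≈ 0# → a * taylor q i ≈ 0#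
  *-taylor-zero a q i qᵢ≈0 = trans (*-congˡ (taylor-zero q i qᵢ≈0)) (zeroʳ a)

  DegreeAtMost : Poly → ℕ → Set ℓ₁
  DegreeAtMost q n = ∀ m → n < m → coeff q m ≈ 0#

  degree≤length : ∀ q → DegreeAtMost q (length q)
  degree≤length q m q<m = coeff-length q m (ℕ.<⇒≤ q<m)

  coeff-X^-self : ∀ n → coeff (X^ n) n ≡ 1#
  coeff-X^-self zero    = ≡.refl
  coeff-X^-self (suc n) = coeff-X^-self n

  coeff-X^-≢ : ∀ n i → n ≢ i → coeff (X^ n) i ≡ 0#
  coeff-X^-≢ zero    zero    n≢i = ⊥-elim (n≢i ≡.refl)
  coeff-X^-≢ zero    (suc i) n≢i = ≡.refl
  coeff-X^-≢ (suc n) zero    n≢i = ≡.refl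
  coeff-X^-≢ (suc n) (suc i) n≢i = coeff-X^-≢ n i λ n≡i → n≢i (≡.cong suc n≡i)

  coeff-X^-shift : ∀ {k n} i → k ≤ n → coeff (X^ (n ∸ k)) i ≡ coeff (X^ n) (i ℕ.+ k)
  coeff-X^-shift {n = n} i z≤n = ≡.cong (coeff (X^ n)) (≡.sym (ℕ.+-identityʳ i))
  coeff-X^-shift {suc k} {suc n} i (s≤s k≤n) = ≡.trans (coeff-X^-shift i k≤n)
    (≡.cong (coeff (X^ (suc n))) (≡.sym (ℕ.+-suc i k)))

  -- The coefficient vanishes unless `i` is `n`, so the varying factor `i !` may be traded for the
  -- fixed `n !`.
  taylor-X^ : ∀ n i → taylor (X^ n) i ≈ (n !) ℕ· coeff (X^ n) i
  taylor-X^ n i with n ℕ.≟ i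
  ... | yes ≡.refl = refl
  ... | no  n≢i    = trans (taylor-zero (X^ n) i Xⁿᵢ≈0)
                       (sym (trans (×-congʳ (n !) Xⁿᵢ≈0) (×-zeroʳ (n !))))
    where Xⁿᵢ≈0 = reflexive (coeff-X^-≢ n i n≢i)

  degree-X^ : ∀ n → DegreeAtMost (X^ n) n
  degree-X^ n m n<m = reflexive (coeff-X^-≢ n m (ℕ.<⇒≢ n<m))

  ⟦⟧-sum : ∀ q x → ⟦ q ⟧ x ≈ ∑[ i < length q ] (coeff q (toℕ i) * x ^ toℕ i)
  ⟦⟧-sum []      x = refl
  ⟦⟧-sum (a ∷ q) x = +-cong (sym (*-identityʳ a)) (begin
    x * ⟦ q ⟧ x
      ≈⟨ *-congˡ (⟦⟧-sum q x) ⟩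
    x * ∑[ i < length q ] (coeff q (toℕ i) * x ^ toℕ i)
      ≈⟨ *-distribˡ-sum {length q} x (λ i → coeff q (toℕ i) * x ^ toℕ i) ⟩
    ∑[ i < length q ] (x * (coeff q (toℕ i) * x ^ toℕ i))
      ≈⟨ sum-cong-≋ {length q} (λ i → solve 3 (λ x a y → x :* (a :* y) := a :* (x :* y))
           refl x (coeff q (toℕ i)) (x ^ toℕ i)) ⟩
    ∑[ i < length q ] (coeff q (toℕ i) * (x * x ^ toℕ i)) ∎)
    where open SemiringSolver commutativeSemiring using (solve; _:*_; _:=_)

  ∑-X^ : ∀ n (w : ℕ → Carrier) → ∑[ i < length (X^ n) ] (coeff (X^ n) (toℕ i) * w (toℕ i)) ≈ w n
  ∑-X^ zero    w = trans (+-identityʳ _) (*-identityˡ (w 0))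
  ∑-X^ (suc n) w = trans (+-cong (zeroˡ (w 0)) (∑-X^ n (λ i → w (suc i)))) (+-identityˡ _)

-- Umbral calculus: functionals and differential operators

n∸[j∸k]≡n∸j+k : ∀ {n j k} → k ≤ j → j ≤ n → n ∸ (j ∸ k) ≡ n ∸ j ℕ.+ k
n∸[j∸k]≡n∸j+k {n} {j} z≤n j≤n = ≡.sym (ℕ.+-identityʳ (n ∸ j))
n∸[j∸k]≡n∸j+k {suc n} {suc j} {suc k} (s≤s k≤j) (s≤s j≤n) = begin
  suc n ∸ (j ∸ k)      ≡⟨ ℕ.+-∸-assoc 1 (ℕ.≤-trans (ℕ.m∸n≤m j k) j≤n) ⟩
  suc (n ∸ (j ∸ k))    ≡⟨ ≡.cong suc (n∸[j∸k]≡n∸j+k k≤j j≤n) ⟩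
  suc (n ∸ j ℕ.+ k)    ≡⟨ ℕ.+-suc (n ∸ j) k ⟨
  n ∸ j ℕ.+ suc k      ∎
  where open ≡.≡-Reasoning

module UmbralCalculus {c ℓ₁ ℓ₂} (F : HeytingField c ℓ₁ ℓ₂)
         (ℚ→F : ℚ → HeytingField.Carrier F) (isFieldHom : IsFieldHom ℚ-field F ℚ→F) where
  open FieldOps F
  open Polynomials F
  open PolynomialCoefficients F
  open Umbral F ℚ→F isFieldHom
  open FiniteSums F
  open PowerSeriesAlgebra F ℚ→F isFieldHom
  open Exponential F ℚ→F isFieldHom
  open ≈-Reasoning setoid

  coeff-▹ : ∀ f q i → coeff (f ▹ q) i ≈ ∑[ k < length q ] (f (toℕ k) * coeff (deriv^ (toℕ k) q) i)
  coeff-▹ f q i = trans (coeff-⨁ (length q) (λ k → f k • deriv^ k q) i)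
    (sum-cong-≋ {length q} λ k → coeff-• (f (toℕ k)) (deriv^ (toℕ k) q) i)

  ▹-cong : ∀ {f g} q → f ≈ₛ g → f ▹ q ≋ g ▹ q
  ▹-cong {f} {g} q f≈g i = begin
    coeff (f ▹ q) i                                                   ≈⟨ coeff-▹ f q i ⟩
    ∑[ k < length q ] (f (toℕ k) * coeff (deriv^ (toℕ k) q) i)        ≈⟨ sum-cong-≋ {length q} (λ k → *-congʳ (f≈g (toℕ k))) ⟩
    ∑[ k < length q ] (g (toℕ k) * coeff (deriv^ (toℕ k) q) i)        ≈⟨ coeff-▹ g q i ⟨
    coeff (g ▹ q) i                                                   ∎

  -- The `k`-th derivative shifts the index by `k`, so the operator becomes a correlation with `f`;
  -- reversing the index will make it a convolution.
  taylor-▹ : ∀ f q i → taylor (f ▹ q) i ≈ ∑[ k < length q ] (f (toℕ k) * taylor q (i ℕ.+ toℕ k))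
  taylor-▹ f q i = begin
    (i !) ℕ· coeff (f ▹ q) i
      ≈⟨ trans (×-congʳ (i !) (coeff-▹ f q i)) (×-as-* (i !) _) ⟩
    ((i !) ℕ· 1#) * ∑[ k < length q ] (f (toℕ k) * coeff (deriv^ (toℕ k) q) i)
      ≈⟨ *-distribˡ-sum {length q} ((i !) ℕ· 1#) (λ k → f (toℕ k) * coeff (deriv^ (toℕ k) q) i) ⟩
    ∑[ k < length q ] (((i !) ℕ· 1#) * (f (toℕ k) * coeff (deriv^ (toℕ k) q) i))
      ≈⟨ sum-cong-≋ {length q} (λ k → term (toℕ k)) ⟩
    ∑[ k < length q ] (f (toℕ k) * taylor q (i ℕ.+ toℕ k)) ∎
    where
    term : ∀ k → ((i !) ℕ· 1#) * (f k * coeff (deriv^ k q) i) ≈ f k * taylor q (i ℕ.+ k)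
    term k = begin
      ((i !) ℕ· 1#) * (f k * coeff (deriv^ k q) i)   ≈⟨ ×-as-* (i !) _ ⟨
      (i !) ℕ· (f k * coeff (deriv^ k q) i)          ≈⟨ ×-comm-* (i !) (f k) _ ⟨
      f k * taylor (deriv^ k q) i                    ≈⟨ *-congˡ (taylor-deriv^ k q i) ⟩
      f k * taylor q (i ℕ.+ k)                       ∎

  -- By `taylor-▹` only derivatives of `q` of order at least `m` enter, and these vanish for `m`
  -- above `n`.
  degree-▹ : ∀ f q n → DegreeAtMost q n → DegreeAtMost (f ▹ q) n
  degree-▹ f q n q≤n m n<m = !-cancel m (begin
    taylor (f ▹ q) m
      ≈⟨ taylor-▹ f q m ⟩
    ∑[ k < length q ] (f (toℕ k) * taylor q (m ℕ.+ toℕ k))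
      ≈⟨ ∑-zero (length q) {λ k → f k * taylor q (m ℕ.+ k)} (λ k →
           *-taylor-zero (f k) q (m ℕ.+ k) (q≤n (m ℕ.+ k) (ℕ.m≤n⇒m≤n+o k n<m))) ⟩
    0#
      ≈⟨ ×-zeroʳ (m !) ⟨
    (m !) ℕ· 0# ∎)

  -- The derivatives at 0 of a polynomial of degree at most n, from the n-th
  -- down; f ▹_ then becomes multiplication by f and ⟨ f ∣_⟩ an n-th coefficient.
  reversed : ℕ → Poly → PowerSeries
  reversed n q j = taylor q (n ∸ j)

  -- The sum of `taylor-▹` may stop at `k ≤ j`, since for larger `k` the index `n ∸ j ℕ.+ k` exceeds
  -- the degree bound; what remains is a convolution.
  reversed-▹ : ∀ f q {n j} → DegreeAtMost q n → j ≤ n → reversed n (f ▹ q) j ≈ (f *ₛ reversed n q) j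
  reversed-▹ f q {n} {j} q≤n j≤n = begin
    taylor (f ▹ q) (n ∸ j)
      ≈⟨ taylor-▹ f q (n ∸ j) ⟩
    ∑[ k < length q ] (f (toℕ k) * taylor q (n ∸ j ℕ.+ toℕ k))
      ≈⟨ ∑-range (length q) (suc j) {λ k → f k * taylor q (n ∸ j ℕ.+ k)}
           (λ k q≤k → *-taylor-zero (f k) q _ (coeff-length q _ (ℕ.m≤n⇒m≤o+n (n ∸ j) q≤k)))
           (λ k j<k → *-taylor-zero (f k) q _ (q≤n _ (n<n∸j+k j<k))) ⟩
    ∑[ k ≤ j ] (f (toℕ k) * taylor q (n ∸ j ℕ.+ toℕ k))
      ≈⟨ ∑-cong (suc j) {λ k → f k * taylor q (n ∸ j ℕ.+ k)} {λ k → f k * taylor q (n ∸ (j ∸ k))}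
           (λ k k≤j → *-congˡ (reflexive (≡.cong (taylor q) (≡.sym (n∸[j∸k]≡n∸j+k (ℕ.s≤s⁻¹ k≤j) j≤n))))) ⟩
    (f *ₛ reversed n q) j ∎
    where
    n<n∸j+k : ∀ {k} → j < k → n < n ∸ j ℕ.+ k
    n<n∸j+k j<k = ℕ.≤-trans (s≤s (ℕ.≤-reflexive (≡.sym (ℕ.m∸n+n≡m j≤n))))
      (ℕ.+-monoʳ-< (n ∸ j) j<k)

  ⟨∣⟩-taylor : ∀ f q → ⟨ f ∣ q ⟩ ≈ ∑[ i < length q ] (f (toℕ i) * taylor q (toℕ i))
  ⟨∣⟩-taylor f q = sum-cong-≋ {length q} λ i → begin
    coeff q (toℕ i) * ((toℕ i !) ℕ· f (toℕ i))   ≈⟨ ×-comm-* (toℕ i !) _ _ ⟩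
    (toℕ i !) ℕ· (coeff q (toℕ i) * f (toℕ i))   ≈⟨ ×-congʳ (toℕ i !) (*-comm _ _) ⟩
    (toℕ i !) ℕ· (f (toℕ i) * coeff q (toℕ i))   ≈⟨ ×-comm-* (toℕ i !) _ _ ⟨
    f (toℕ i) * taylor q (toℕ i)                 ∎

  -- In the `n`-th coefficient the convolution index `n ∸ i` is reversed once more, which restores
  -- `i`.
  ⟨∣⟩-reversed : ∀ f q n → DegreeAtMost q n → ⟨ f ∣ q ⟩ ≈ (f *ₛ reversed n q) n
  ⟨∣⟩-reversed f q n q≤n = begin
    ⟨ f ∣ q ⟩
      ≈⟨ ⟨∣⟩-taylor f q ⟩
    ∑[ i < length q ] (f (toℕ i) * taylor q (toℕ i))
      ≈⟨ ∑-range (length q) (suc n) {λ i → f i * taylor q i}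
           (λ i q≤i → *-taylor-zero (f i) q i (coeff-length q i q≤i))
           (λ i n<i → *-taylor-zero (f i) q i (q≤n i n<i)) ⟩
    ∑[ i ≤ n ] (f (toℕ i) * taylor q (toℕ i))
      ≈⟨ ∑-cong (suc n) {λ i → f i * taylor q i} {λ i → f i * taylor q (n ∸ (n ∸ i))}
           (λ i i≤n → *-congˡ (reflexive (≡.cong (taylor q) (≡.sym (ℕ.m∸[m∸n]≡n (ℕ.s≤s⁻¹ i≤n)))))) ⟩
    (f *ₛ reversed n q) n ∎

  ⟨∣⟩-congˡ : ∀ {f g} q → f ≈ₛ g → ⟨ f ∣ q ⟩ ≈ ⟨ g ∣ q ⟩
  ⟨∣⟩-congˡ q f≈g = sum-cong-≋ {length q} λ i → *-congˡ (×-congʳ (toℕ i !) (f≈g (toℕ i)))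

  -- Equal polynomials may have lists of different lengths, over which the two pairings sum; the
  -- surplus terms come from trailing zeros.
  ⟨∣⟩-congʳ : ∀ f q q′ → q ≋ q′ → ⟨ f ∣ q ⟩ ≈ ⟨ f ∣ q′ ⟩
  ⟨∣⟩-congʳ f q q′ q≋q′ = begin
    ∑[ i < length q ] (coeff q (toℕ i) * ((toℕ i !) ℕ· f (toℕ i)))
      ≈⟨ ∑-range (length q) (length q′) {λ i → coeff q i * ((i !) ℕ· f i)}
           (λ i q≤i → zero-term i (coeff-length q i q≤i))
           (λ i q′≤i → zero-term i (trans (q≋q′ i) (coeff-length q′ i q′≤i))) ⟩
    ∑[ i < length q′ ] (coeff q (toℕ i) * ((toℕ i !) ℕ· f (toℕ i)))
      ≈⟨ sum-cong-≋ {length q′} (λ i → *-congʳ (q≋q′ (toℕ i))) ⟩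
    ⟨ f ∣ q′ ⟩ ∎
    where
    zero-term : ∀ i → coeff q i ≈ 0# → coeff q i * ((i !) ℕ· f i) ≈ 0#
    zero-term i qᵢ≈0 = trans (*-congʳ qᵢ≈0) (zeroˡ _)

  ⟨∣⟩-+ : ∀ f g q → ⟨ f +ₛ g ∣ q ⟩ ≈ ⟨ f ∣ q ⟩ + ⟨ g ∣ q ⟩
  ⟨∣⟩-+ f g q = begin
    ⟨ f +ₛ g ∣ q ⟩
      ≈⟨ ⟨∣⟩-taylor (f +ₛ g) q ⟩
    ∑[ i < length q ] ((f (toℕ i) + g (toℕ i)) * taylor q (toℕ i))
      ≈⟨ sum-cong-≋ {length q} (λ i → distribʳ (taylor q (toℕ i)) (f (toℕ i)) (g (toℕ i))) ⟩
    ∑[ i < length q ] (f (toℕ i) * taylor q (toℕ i) + g (toℕ i) * taylor q (toℕ i))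
      ≈⟨ ∑-distrib-+ {length q} (λ i → f (toℕ i) * taylor q (toℕ i)) (λ i → g (toℕ i) * taylor q (toℕ i)) ⟩
    ∑[ i < length q ] (f (toℕ i) * taylor q (toℕ i)) + ∑[ i < length q ] (g (toℕ i) * taylor q (toℕ i))
      ≈⟨ +-cong (⟨∣⟩-taylor f q) (⟨∣⟩-taylor g q) ⟨
    ⟨ f ∣ q ⟩ + ⟨ g ∣ q ⟩ ∎

  ⟨∣⟩-scale : ∀ a f q → ⟨ (λ n → a * f n) ∣ q ⟩ ≈ a * ⟨ f ∣ q ⟩
  ⟨∣⟩-scale a f q = begin
    ⟨ (λ n → a * f n) ∣ q ⟩
      ≈⟨ ⟨∣⟩-taylor (λ n → a * f n) q ⟩
    ∑[ i < length q ] (a * f (toℕ i) * taylor q (toℕ i))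
      ≈⟨ sum-cong-≋ {length q} (λ i → *-assoc a (f (toℕ i)) (taylor q (toℕ i))) ⟩
    ∑[ i < length q ] (a * (f (toℕ i) * taylor q (toℕ i)))
      ≈⟨ *-distribˡ-sum {length q} a (λ i → f (toℕ i) * taylor q (toℕ i)) ⟨
    a * ∑[ i < length q ] (f (toℕ i) * taylor q (toℕ i))
      ≈⟨ *-congˡ (⟨∣⟩-taylor f q) ⟨
    a * ⟨ f ∣ q ⟩ ∎

  ⟨∣⟩-X^ : ∀ f n → ⟨ f ∣ X^ n ⟩ ≈ (n !) ℕ· f n
  ⟨∣⟩-X^ f n = ∑-X^ n (λ i → (i !) ℕ· f i)

  -- Multiplication by `f` on series is adjoint to the operator of `f` on polynomials: read as
  -- `n`-th coefficients, the two sides differ by a bracketing.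
  ⟨∣▹⟩ : ∀ h f q → ⟨ h ∣ f ▹ q ⟩ ≈ ⟨ h *ₛ f ∣ q ⟩
  ⟨∣▹⟩ h f q = begin
    ⟨ h ∣ f ▹ q ⟩                    ≈⟨ ⟨∣⟩-reversed h (f ▹ q) n (degree-▹ f q n q≤n) ⟩
    (h *ₛ reversed n (f ▹ q)) n      ≈⟨ *ₛ-cong-≤ {h} n (λ _ _ → refl) (λ j j≤n → reversed-▹ f q q≤n j≤n) ⟩
    (h *ₛ (f *ₛ reversed n q)) n     ≈⟨ *ₛ-assoc h f (reversed n q) n ⟨
    (h *ₛ f *ₛ reversed n q) n       ≈⟨ ⟨∣⟩-reversed (h *ₛ f) q n q≤n ⟨
    ⟨ h *ₛ f ∣ q ⟩                   ∎
    where
    -- Any degree bound serves; the length is not sharp but also covers the empty list.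
    n   = length q
    q≤n = degree≤length q

  ⟦⟧-exp : ∀ q x → ⟦ q ⟧ x ≈ ⟨ exp x ∣ q ⟩
  ⟦⟧-exp q x = trans (⟦⟧-sum q x)
    (sum-cong-≋ {length q} λ i → *-congˡ (sym (×-1/n! (toℕ i) (x ^ toℕ i))))

  ⟦⟧-cong : ∀ q {x y} → x ≈ y → ⟦ q ⟧ x ≈ ⟦ q ⟧ y
  ⟦⟧-cong []      x≈y = refl
  ⟦⟧-cong (a ∷ q) x≈y = +-congˡ (*-cong x≈y (⟦⟧-cong q x≈y))

  ⟦▹⟧ : ∀ f q x → ⟦ f ▹ q ⟧ x ≈ ⟨ exp x *ₛ f ∣ q ⟩
  ⟦▹⟧ f q x = trans (⟦⟧-exp (f ▹ q) x) (⟨∣▹⟩ (exp x) f q)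

  ⟦1▹⟧ : ∀ q x → ⟦ const 1# ▹ q ⟧ x ≈ ⟦ q ⟧ x
  ⟦1▹⟧ q x = begin
    ⟦ const 1# ▹ q ⟧ x              ≈⟨ ⟦▹⟧ (const 1#) q x ⟩
    ⟨ exp x *ₛ const 1# ∣ q ⟩       ≈⟨ ⟨∣⟩-congˡ q (λ n → trans (*ₛ-comm (exp x) (const 1#) n) (*ₛ-identityˡ (exp x) n)) ⟩
    ⟨ exp x ∣ q ⟩                   ≈⟨ ⟦⟧-exp q x ⟨
    ⟦ q ⟧ x                         ∎

  -- Values suffice, as the integrals see only values. The order `g *ₛ f` matches the unfolding of
  -- `2/[eᵗ+1] ^ₛ suc r`.
  ⟦▹▹⟧ : ∀ f g q x → ⟦ f ▹ g ▹ q ⟧ x ≈ ⟦ (g *ₛ f) ▹ q ⟧ x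
  ⟦▹▹⟧ f g q x = begin
    ⟦ f ▹ g ▹ q ⟧ x               ≈⟨ ⟦▹⟧ f (g ▹ q) x ⟩
    ⟨ exp x *ₛ f ∣ g ▹ q ⟩        ≈⟨ ⟨∣▹⟩ (exp x *ₛ f) g q ⟩
    ⟨ exp x *ₛ f *ₛ g ∣ q ⟩       ≈⟨ ⟨∣⟩-congˡ q (λ n → trans (*ₛ-swapʳ (exp x) f g n) (*ₛ-assoc (exp x) g f n)) ⟩
    ⟨ exp x *ₛ (g *ₛ f) ∣ q ⟩     ≈⟨ ⟦▹⟧ (g *ₛ f) q x ⟨
    ⟦ (g *ₛ f) ▹ q ⟧ x            ∎

  -- Evaluations at `1# + y` and `y` are functionals of exponentials, whose sum is `eᵗ+1 *ₛ exp y`;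
  -- the factor `eᵗ+1` cancels the denominator of `2/[eᵗ+1]`.
  ⟦2/[eᵗ+1]▹⟧ : ∀ q y → ⟦ 2/[eᵗ+1] ▹ q ⟧ (1# + y) + ⟦ 2/[eᵗ+1] ▹ q ⟧ y ≈ (1# + 1#) * ⟦ q ⟧ y
  ⟦2/[eᵗ+1]▹⟧ q y = begin
    ⟦ A ▹ q ⟧ (1# + y) + ⟦ A ▹ q ⟧ y                   ≈⟨ +-cong (⟦▹⟧ A q (1# + y)) (⟦▹⟧ A q y) ⟩
    ⟨ exp (1# + y) *ₛ A ∣ q ⟩ + ⟨ exp y *ₛ A ∣ q ⟩     ≈⟨ ⟨∣⟩-+ (exp (1# + y) *ₛ A) (exp y *ₛ A) q ⟨
    ⟨ exp (1# + y) *ₛ A +ₛ exp y *ₛ A ∣ q ⟩            ≈⟨ ⟨∣⟩-congˡ q shifted ⟩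
    ⟨ (λ n → (1# + 1#) * exp y n) ∣ q ⟩                ≈⟨ ⟨∣⟩-scale (1# + 1#) (exp y) q ⟩
    (1# + 1#) * ⟨ exp y ∣ q ⟩                          ≈⟨ *-congˡ (⟦⟧-exp q y) ⟨
    (1# + 1#) * ⟦ q ⟧ y                                ∎
    where
    A = 2/[eᵗ+1]
    exp-shift : exp (1# + y) +ₛ exp y ≈ₛ eᵗ+1 *ₛ exp y
    exp-shift n = begin
      exp (1# + y) n + exp y n                    ≈⟨ +-cong (exp-+ 1# y n) (sym (*ₛ-identityˡ (exp y) n)) ⟩
      (exp 1# *ₛ exp y) n + (const 1# *ₛ exp y) n ≈⟨ +-congʳ (*ₛ-cong {g = exp y} exp-1 (λ _ → refl) n) ⟩
      (eᵗ *ₛ exp y +ₛ const 1# *ₛ exp y) n        ≈⟨ *ₛ-distribʳ eᵗ (const 1#) (exp y) n ⟨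
      (eᵗ+1 *ₛ exp y) n                           ∎
    shifted : exp (1# + y) *ₛ A +ₛ exp y *ₛ A ≈ₛ λ n → (1# + 1#) * exp y n
    shifted n = begin
      (exp (1# + y) *ₛ A +ₛ exp y *ₛ A) n   ≈⟨ *ₛ-distribʳ (exp (1# + y)) (exp y) A n ⟨
      ((exp (1# + y) +ₛ exp y) *ₛ A) n      ≈⟨ *ₛ-cong {g = A} exp-shift (λ _ → refl) n ⟩
      (eᵗ+1 *ₛ exp y *ₛ A) n                ≈⟨ *ₛ-swapʳ eᵗ+1 (exp y) A n ⟩
      (eᵗ+1 *ₛ A *ₛ exp y) n                ≈⟨ *ₛ-cong {g = exp y} (*ₛ-comm eᵗ+1 A) (λ _ → refl) n ⟩
      (A *ₛ eᵗ+1 *ₛ exp y) n                ≈⟨ *ₛ-cong {g = exp y} (quotient-*ₛ (const (1# + 1#)) eᵗ+1 eᵗ+1-invertible) (λ _ → refl) n ⟩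
      (const (1# + 1#) *ₛ exp y) n          ≈⟨ const-*ₛ (1# + 1#) (exp y) n ⟩
      (1# + 1#) * exp y n                   ∎

-- Apartness from zero

module HeytingFieldProperties {c ℓ₁ ℓ₂} (F : HeytingField c ℓ₁ ℓ₂) where
  open FieldOps F
  private H = HeytingField.heytingCommutativeRing F

  xy≈1⇒x#0 : ∀ {x y} → x * y ≈ 1# → x # 0#
  xy≈1⇒x#0 {x} {y} xy≈1 = invertibleʳ⇒# H (y , trans (*-congʳ (x-0≈x H x)) xy≈1)

  -- The inverse of `x * y`, multiplied by `y`, inverts `x`.
  xy#0⇒x#0 : ∀ {x y} → x * y # 0# → x # 0#
  xy#0⇒x#0 {x} {y} xy#0 = xy≈1⇒x#0 (trans (sym (*-assoc x y (inv xy#0)))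
    (trans (*-congʳ (sym (x-0≈x H (x * y)))) (proj₂ (proj₂ (#⇒invertible xy#0)))))

  xy#0⇒y#0 : ∀ {x y} → x * y # 0# → y # 0#
  xy#0⇒y#0 {x} {y} xy#0 = xy#0⇒x#0 (#-congʳ H (*-comm x y) xy#0)

-- Appell sequences and their generating functions

module AppellSequences {c ℓ₁ ℓ₂} (F : HeytingField c ℓ₁ ℓ₂)
         (ℚ→F : ℚ → HeytingField.Carrier F) (isFieldHom : IsFieldHom ℚ-field F ℚ→F) where
  open FieldOps F
  open Polynomials F
  open HeytingFieldProperties F
  open PolynomialCoefficients F
  open Umbral F ℚ→F isFieldHom
  open RingMorphisms.IsRingHomomorphism isFieldHom
  open FiniteSums F
  open PowerSeriesAlgebra F ℚ→F isFieldHom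
  open Exponential F ℚ→F isFieldHom
  open UmbralCalculus F ℚ→F isFieldHom
  open SemiringSolver commutativeSemiring using (solve; _:*_; _:=_)
  open ≈-Reasoning setoid
  private H = HeytingField.heytingCommutativeRing F

  -- Links the generating function to the operator: for `f` a power of `2/[eᵗ+1]` the left side is
  -- `euler`. Scaled by `i !`, both sides become the sum of `taylor-▹`.
  ▹X^≋*ₓeˣᵗ : ∀ f n → ((n !) ℕ· 1#) • (f *ₓ eˣᵗ) n ≋ f ▹ X^ n
  ▹X^≋*ₓeˣᵗ f n i = !-cancel i (begin
    (i !) ℕ· coeff (N • (f *ₓ eˣᵗ) n) i
      ≈⟨ ×-congʳ (i !) (trans (coeff-• N ((f *ₓ eˣᵗ) n) i) (*-congˡ coeff-*ₓ)) ⟩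
    (i !) ℕ· (N * ∑[ k ≤ n ] summand (toℕ k))
      ≈⟨ trans (×-as-* (i !) _) (sym (*-assoc _ _ _)) ⟩
    ((i !) ℕ· 1#) * N * ∑[ k ≤ n ] summand (toℕ k)
      ≈⟨ *-distribˡ-sum {suc n} (((i !) ℕ· 1#) * N) (λ k → summand (toℕ k)) ⟩
    ∑[ k ≤ n ] (((i !) ℕ· 1#) * N * summand (toℕ k))
      ≈⟨ ∑-cong (suc n) {λ k → ((i !) ℕ· 1#) * N * summand k} {λ k → f k * taylor (X^ n) (i ℕ.+ k)}
           (λ k k≤n → term k (ℕ.s≤s⁻¹ k≤n)) ⟩
    ∑[ k ≤ n ] (f (toℕ k) * taylor (X^ n) (i ℕ.+ toℕ k))
      ≈⟨ ∑-range (length (X^ n)) (suc n) {λ k → f k * taylor (X^ n) (i ℕ.+ k)}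
           (λ k X^≤k → *-taylor-zero (f k) (X^ n) _ (coeff-length (X^ n) _ (ℕ.m≤n⇒m≤o+n i X^≤k)))
           (λ k n<k → *-taylor-zero (f k) (X^ n) _ (degree-X^ n _ (ℕ.m≤n⇒m≤o+n i n<k))) ⟨
    ∑[ k < length (X^ n) ] (f (toℕ k) * taylor (X^ n) (i ℕ.+ toℕ k))
      ≈⟨ taylor-▹ f (X^ n) i ⟨
    taylor (f ▹ X^ n) i ∎)
    where
    N = (n !) ℕ· 1#
    summand : ℕ → Carrier
    summand k = f k * (1/ (n ∸ k) ! * coeff (X^ (n ∸ k)) i)
    coeff-*ₓ : coeff ((f *ₓ eˣᵗ) n) i ≈ ∑[ k ≤ n ] summand (toℕ k)
    coeff-*ₓ = trans (coeff-⨁ (suc n) (λ k → f k • eˣᵗ (n ∸ k)) i)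
      (sum-cong-≋ {suc n} λ k → trans (coeff-• (f (toℕ k)) (eˣᵗ (n ∸ toℕ k)) i)
        (*-congˡ (coeff-• (1/ (n ∸ toℕ k) !) (X^ (n ∸ toℕ k)) i)))
    term : ∀ k → k ≤ n → ((i !) ℕ· 1#) * N * summand k ≈ f k * taylor (X^ n) (i ℕ.+ k)
    term k k≤n = begin
      ((i !) ℕ· 1#) * N * summand k
        ≈⟨ solve 5 (λ a b c d e → a :* b :* (c :* (d :* e)) := c :* (b :* (d :* (a :* e))))
             refl ((i !) ℕ· 1#) N (f k) (1/ (n ∸ k) !) (coeff (X^ (n ∸ k)) i) ⟩
      f k * (N * (1/ (n ∸ k) ! * (((i !) ℕ· 1#) * coeff (X^ (n ∸ k)) i)))
        -- Only `i` equal to `n ∸ k` contributes, so `i !` may become `(n ∸ k) !`, which cancels its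
        -- reciprocal.
        ≈⟨ *-congˡ (*-congˡ (*-congˡ (trans (sym (×-as-* (i !) _)) (taylor-X^ (n ∸ k) i)))) ⟩
      f k * (N * (1/ (n ∸ k) ! * (((n ∸ k) !) ℕ· coeff (X^ (n ∸ k)) i)))
        ≈⟨ *-congˡ (*-congˡ (1/n!-× (n ∸ k) _)) ⟩
      f k * (N * coeff (X^ (n ∸ k)) i)
        ≈⟨ *-congˡ (*-congˡ (reflexive (coeff-X^-shift i k≤n))) ⟩
      f k * (N * coeff (X^ n) (i ℕ.+ k))
        ≈⟨ *-congˡ (trans (sym (×-as-* (n !) _)) (sym (taylor-X^ n (i ℕ.+ k)))) ⟩
      f k * taylor (X^ n) (i ℕ.+ k) ∎

  t-*ₛ : ∀ f n → (t *ₛ f) (suc n) ≈ f n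
  t-*ₛ f n = begin
    0# * f (suc n) + ((λ k → t (suc k)) *ₛ f) n  ≈⟨ +-cong (zeroˡ _) (*ₛ-cong {g = f} tail-t (λ _ → refl) n) ⟩
    0# + (const 1# *ₛ f) n                       ≈⟨ +-identityˡ _ ⟩
    (const 1# *ₛ f) n                            ≈⟨ *ₛ-identityˡ f n ⟩
    f n                                          ∎
    where
    tail-t : (λ k → t (suc k)) ≈ₛ const 1#
    tail-t zero    = refl
    tail-t (suc _) = refl

  t^ₛ : ∀ k n → (t ^ₛ k) n ≈ coeff (X^ k) n
  t^ₛ zero    zero    = refl
  t^ₛ zero    (suc n) = refl
  t^ₛ (suc k) zero    = trans (+-identityʳ _) (zeroˡ _)
  t^ₛ (suc k) (suc n) = trans (t-*ₛ (t ^ₛ k) n) (t^ₛ k n)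

  n!δ-X^ : ∀ n k → (n !) ℕ· coeff (X^ k) n ≈ n!δ n k
  n!δ-X^ n k with n ℕ.≟ k
  ... | yes ≡.refl = ×-congʳ (n !) (reflexive (coeff-X^-self n))
  ... | no  n≢k    = trans (×-congʳ (n !) (reflexive (coeff-X^-≢ k n λ k≡n → n≢k (≡.sym k≡n)))) (×-zeroʳ (n !))

  -- The leading coefficient sits at reversed index 0, where the convolution has a single term.
  coeff-▹X^-lead : ∀ f n → coeff (f ▹ X^ n) n ≈ f 0
  coeff-▹X^-lead f n = !-cancel n (begin
    taylor (f ▹ X^ n) n                       ≈⟨ reversed-▹ f (X^ n) (degree-X^ n) z≤n ⟩
    f 0 * taylor (X^ n) n + 0#                ≈⟨ +-identityʳ _ ⟩
    f 0 * ((n !) ℕ· coeff (X^ n) n)           ≈⟨ ×-comm-* (n !) (f 0) _ ⟩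
    (n !) ℕ· (f 0 * coeff (X^ n) n)           ≈⟨ ×-congʳ (n !) (*-congˡ (reflexive (coeff-X^-self n))) ⟩
    (n !) ℕ· (f 0 * 1#)                       ≈⟨ ×-congʳ (n !) (*-identityʳ (f 0)) ⟩
    (n !) ℕ· f 0                              ∎)

  *ₛ≈1⇒head#0 : ∀ f g → f *ₛ g ≈ₛ const 1# → f 0 # 0#
  *ₛ≈1⇒head#0 f g fg≈1 = xy≈1⇒x#0 (trans (sym (+-identityʳ _)) (fg≈1 0))

  -- The adjunction moves `f` into the functional, where it cancels `g` and leaves a power of `t`.
  -- The same equation makes both constant terms invertible, which gives the exact degree.
  appell : ∀ g f → g *ₛ f ≈ₛ const 1# → (s : ℕ → Poly) → (∀ n → s n ≋ f ▹ X^ n) → Appell g s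
  appell g f gf≈1 s s≋f▹X^ = record
    { g-invertible = *ₛ≈1⇒head#0 g f gf≈1
    ; f-const      = refl
    ; f-linear     = 1#0 H
    ; degree       = λ n →
        #-congʳ H (sym (trans (s≋f▹X^ n n) (coeff-▹X^-lead f n)))
          (*ₛ≈1⇒head#0 f g (λ k → trans (*ₛ-comm f g k) (gf≈1 k))) ,
        λ m n<m → trans (s≋f▹X^ n m) (degree-▹ f (X^ n) n (degree-X^ n) m n<m)
    ; orthogonal   = λ n k → begin
        ⟨ g *ₛ t ^ₛ k ∣ s n ⟩             ≈⟨ ⟨∣⟩-congʳ (g *ₛ t ^ₛ k) (s n) (f ▹ X^ n) (s≋f▹X^ n) ⟩
        ⟨ g *ₛ t ^ₛ k ∣ f ▹ X^ n ⟩        ≈⟨ ⟨∣▹⟩ (g *ₛ t ^ₛ k) f (X^ n) ⟩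
        ⟨ g *ₛ t ^ₛ k *ₛ f ∣ X^ n ⟩       ≈⟨ ⟨∣⟩-X^ (g *ₛ t ^ₛ k *ₛ f) n ⟩
        (n !) ℕ· (g *ₛ t ^ₛ k *ₛ f) n     ≈⟨ ×-congʳ (n !) (cancel k n) ⟩
        (n !) ℕ· coeff (X^ k) n           ≈⟨ n!δ-X^ n k ⟩
        n!δ n k                           ∎
    }
    where
    cancel : ∀ k n → (g *ₛ t ^ₛ k *ₛ f) n ≈ coeff (X^ k) n
    cancel k n = begin
      (g *ₛ t ^ₛ k *ₛ f) n         ≈⟨ *ₛ-swapʳ g (t ^ₛ k) f n ⟩
      (g *ₛ f *ₛ t ^ₛ k) n         ≈⟨ *ₛ-cong {g = t ^ₛ k} gf≈1 (λ _ → refl) n ⟩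
      (const 1# *ₛ t ^ₛ k) n       ≈⟨ *ₛ-identityˡ (t ^ₛ k) n ⟩
      (t ^ₛ k) n                   ≈⟨ t^ₛ k n ⟩
      coeff (X^ k) n               ∎

  -- This is the constant term of `eᵗ+1`.
  2#0 : 1# + 1# # 0#
  2#0 = #-congʳ H (+-congʳ (trans (*-identityʳ _) 1#-homo)) eᵗ+1-invertible

  2/[eᵗ+1]-head#0 : 2/[eᵗ+1] 0 # 0#
  2/[eᵗ+1]-head#0 = xy#0⇒x#0 (#-congʳ H
    (sym (trans (sym (+-identityʳ _)) (quotient-*ₛ (const (1# + 1#)) eᵗ+1 eᵗ+1-invertible 0))) 2#0)

  ^ₛ-head#0 : ∀ f → f 0 # 0# → ∀ r → (f ^ₛ r) 0 # 0#
  ^ₛ-head#0 f f₀#0 zero    = 1#0 H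
  ^ₛ-head#0 f f₀#0 (suc r) = #-congʳ H (sym (+-identityʳ _)) (x#0y#0→xy#0 H f₀#0 (^ₛ-head#0 f f₀#0 r))

-- Valuation estimates and continuity of polynomials

p+[q-p]≡q : ∀ p q → p ℚ.+ (q ℚ.- p) ≡ q
p+[q-p]≡q p q = begin
  p ℚ.+ (q ℚ.- p)      ≡⟨ ℚ.+-comm p (q ℚ.- p) ⟩
  q ℚ.- p ℚ.+ p        ≡⟨ ℚ.+-assoc q (ℚ.- p) p ⟩
  q ℚ.+ (ℚ.- p ℚ.+ p)  ≡⟨ ≡.cong (q ℚ.+_) (ℚ.+-inverseˡ p) ⟩
  q ℚ.+ ℚ.0ℚ           ≡⟨ ℚ.+-identityʳ q ⟩
  q                    ∎
  where open ≡.≡-Reasoning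

-- A denominator is at least 1, so the absolute numerator bounds `q`. This yields an explicit index
-- from which `n`, hence the valuation of the `n`-th power of the prime, exceeds a given rational.
∣numerator∣≤n⇒≤n : ∀ q n → ℤ.∣ ℚ.↥ q ∣ ≤ n → q ℚ.≤ ℤ→ℚ (+ n)
∣numerator∣≤n⇒≤n q@record{} n ∣↥q∣≤n = ℚ.toℚᵘ-cancel-≤ (ℚᵘ.≤-respʳ-≃ (ℚᵘ.≃-sym (ℚ.toℚᵘ-fromℚᵘ (ℚᵘ.mkℚᵘ (+ n) 0)))
  (ℚᵘ.*≤* (begin
    ℚ.↥ q ℤ.* + 1              ≡⟨ ℤ.*-identityʳ (ℚ.↥ q) ⟩
    ℚ.↥ q                      ≤⟨ i≤∣i∣ (ℚ.↥ q) ⟩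
    + ℤ.∣ ℚ.↥ q ∣              ≤⟨ ℤ.+≤+ ∣↥q∣≤n ⟩
    + n                        ≤⟨ ℤ.+≤+ (ℕ.m≤m*n n (suc (ℚ.ℚ.denominator-1 q))) ⟩
    + (n ℕ.* suc (ℚ.ℚ.denominator-1 q))  ≡⟨ ℤ.pos-* n _ ⟩
    + n ℤ.* ℚ.↧ q              ∎)))
  where
  open ℤ.≤-Reasoning
  i≤∣i∣ : ∀ i → i ℤ.≤ + ℤ.∣ i ∣
  i≤∣i∣ (+ n)    = ℤ.≤-refl
  i≤∣i∣ -[1+ n ] = ℤ.-≤+

module ValuationProperties {c ℓ₁ ℓ₂} (K : ValuedField c ℓ₁ ℓ₂) where
  open ValuedField K
  open Polynomials heytingField
  open HeytingFieldProperties heytingField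
  open SemiringSolver commutativeSemiring using (solve; _:+_; _:*_; _:=_)
  open ≈-Reasoning setoid
  private H = HeytingField.heytingCommutativeRing heytingField

  -- The semiring solver has no subtraction; this lemma and the next reduce goals with differences
  -- to identities it can check.
  x+y≈z⇒x≈z-y : ∀ {x y z} → x + y ≈ z → x ≈ z - y
  x+y≈z⇒x≈z-y {x} {y} {z} x+y≈z = begin
    x                ≈⟨ +-identityʳ x ⟨
    x + 0#           ≈⟨ +-congˡ (-‿inverseʳ y) ⟨
    x + (y - y)      ≈⟨ +-assoc x y (- y) ⟨
    x + y - y        ≈⟨ +-congʳ x+y≈z ⟩
    z - y            ∎

  y+[x-y]≈x : ∀ x y → y + (x - y) ≈ x
  y+[x-y]≈x x y = begin
    y + (x - y)      ≈⟨ +-comm y (x - y) ⟩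
    x - y + y        ≈⟨ +-assoc x (- y) y ⟩
    x + (- y + y)    ≈⟨ +-congˡ (-‿inverseˡ y) ⟩
    x + 0#           ≈⟨ +-identityʳ x ⟩
    x                ∎

  ≤v-cong : ∀ {q x y} → x ≈ y → q ≤v x → q ≤v y
  ≤v-cong x≈y q≤x y#0 = ℚ.≤-trans (q≤x x#0) (ℚ.≤-reflexive (v-cong x#0 y#0 x≈y))
    where x#0 = #-congʳ H (sym x≈y) y#0

  ≤v-weaken : ∀ {p q x} → p ℚ.≤ q → q ≤v x → p ≤v x
  ≤v-weaken p≤q q≤x x#0 = ℚ.≤-trans p≤q (q≤x x#0)

  -- If a product is apart from zero, so are its factors; hence no double negation occurs, unlike
  -- for sums.
  ≤v-* : ∀ {p q x y} → p ≤v x → q ≤v y → p ℚ.+ q ≤v x * y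
  ≤v-* p≤x q≤y xy#0 = ℚ.≤-trans (ℚ.+-mono-≤ (p≤x x#0) (q≤y y#0))
    (ℚ.≤-reflexive (≡.sym (v-* x#0 y#0 xy#0)))
    where
    x#0 = xy#0⇒x#0 xy#0
    y#0 = xy#0⇒y#0 xy#0

  -- Whether x # 0# is not decidable, but x # 0# or 1# # x, and in the latter
  -- case x = 1 + (x - 1) with x - 1 # 0#.
  ≤v-bound : ∀ x → ∃[ q ] q ≤v x
  ≤v-bound x with #-cotrans (1#0 H) x
  ... | inj₂ x#0 = v x#0 , λ x#0′ → ℚ.≤-reflexive (v-cong x#0 x#0′ refl)
  ... | inj₁ 1#x = ℚ.0ℚ ℚ.⊓ v x-1#0 , ≤v-cong (y+[x-y]≈x x 1#)
    (≤v-+ (≤v-weaken (ℚ.p⊓q≤p ℚ.0ℚ (v x-1#0)) 0≤v1)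
          (≤v-weaken (ℚ.p⊓q≤q ℚ.0ℚ (v x-1#0)) λ x-1#0′ → ℚ.≤-reflexive (v-cong x-1#0 x-1#0′ refl)))
    where
    x-1#0 : x - 1# # 0#
    x-1#0 = xy≈1⇒x#0 (proj₂ (proj₂ (#⇒invertible (#-sym 1#x))))

  -- Induction along Horner's scheme: if `Δ h` is the increment of `q`, that of `a ∷ q` is
  -- `h * (⟦ q ⟧ s + Δ h) + s * Δ h`.
  ⟦⟧-continuous : ∀ q s B → ∃[ δ ] (∀ h → δ ≤v h → B ≤v ⟦ q ⟧ (s + h) - ⟦ q ⟧ s)
  ⟦⟧-continuous []      s B = ℚ.0ℚ , λ h _ → ≤v-0 (-‿inverseʳ 0#)
  -- Asking `B ℚ.- Bₛ` of `Δ h` settles the term with `s`; then `Bₕ` bounds the valuation of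
  -- `⟦ q ⟧ s + Δ h`, so `h` needs `B ℚ.- Bₕ`.
  ⟦⟧-continuous (a ∷ q) s B = δ ℚ.⊔ (B ℚ.- Bₕ) , λ h δ≤h → ≤v-cong (increment h) (≤v-+
    (≡.subst (_≤v h * (⟦ q ⟧ s + Δ h)) (≡.trans (ℚ.+-comm (B ℚ.- Bₕ) Bₕ) (p+[q-p]≡q Bₕ B))
      (≤v-* (≤v-weaken (ℚ.p≤q⊔p δ (B ℚ.- Bₕ)) δ≤h)
            (≤v-+ (≤v-weaken (ℚ.p⊓q≤p Bq (B ℚ.- Bₛ)) Bq≤q)
                  (≤v-weaken (ℚ.p⊓q≤q Bq (B ℚ.- Bₛ)) (Δ-small h δ≤h)))))
    (≡.subst (_≤v s * Δ h) (p+[q-p]≡q Bₛ B) (≤v-* Bₛ≤s (Δ-small h δ≤h))))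
    where
    Bₛ   = proj₁ (≤v-bound s)
    Bₛ≤s = proj₂ (≤v-bound s)
    Bq   = proj₁ (≤v-bound (⟦ q ⟧ s))
    Bq≤q = proj₂ (≤v-bound (⟦ q ⟧ s))
    Bₕ   = Bq ℚ.⊓ (B ℚ.- Bₛ)
    δ    = proj₁ (⟦⟧-continuous q s (B ℚ.- Bₛ))
    Δ : Carrier → Carrier
    Δ h = ⟦ q ⟧ (s + h) - ⟦ q ⟧ s
    Δ-small : ∀ h → δ ℚ.⊔ (B ℚ.- Bₕ) ≤v h → B ℚ.- Bₛ ≤v Δ h
    Δ-small h δ≤h = proj₂ (⟦⟧-continuous q s (B ℚ.- Bₛ)) h (≤v-weaken (ℚ.p≤p⊔q δ (B ℚ.- Bₕ)) δ≤h)
    increment : ∀ h → h * (⟦ q ⟧ s + Δ h) + s * Δ h ≈ ⟦ a ∷ q ⟧ (s + h) - ⟦ a ∷ q ⟧ s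
    increment h = x+y≈z⇒x≈z-y (begin
      h * (⟦ q ⟧ s + Δ h) + s * Δ h + (a + s * ⟦ q ⟧ s)
        ≈⟨ solve 5 (λ h Q D s a → h :* (Q :+ D) :+ s :* D :+ (a :+ s :* Q) := a :+ (s :+ h) :* (Q :+ D))
             refl h (⟦ q ⟧ s) (Δ h) s a ⟩
      a + (s + h) * (⟦ q ⟧ s + Δ h)
        ≈⟨ +-congˡ (*-congˡ (y+[x-y]≈x (⟦ q ⟧ (s + h)) (⟦ q ⟧ s))) ⟩
      ⟦ a ∷ q ⟧ (s + h) ∎)

-- Field homomorphisms and extensions of valuations

module FieldHomomorphisms {c ℓ₁ ℓ₂ c′ ℓ₁′ ℓ₂′} (K : HeytingField c ℓ₁ ℓ₂) (L : HeytingField c′ ℓ₁′ ℓ₂′)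
         (e : HeytingField.Carrier K → HeytingField.Carrier L) (e-hom : IsFieldHom K L e) where
  private
    module K = FieldOps K
    module L = FieldOps L
  open RingMorphisms.IsRingHomomorphism e-hom

  ×1-homo : ∀ n → e (n K.ℕ· K.1#) L.≈ n L.ℕ· L.1#
  ×1-homo zero    = 0#-homo
  ×1-homo (suc n) = L.trans (+-homo K.1# (n K.ℕ· K.1#)) (L.+-cong 1#-homo (×1-homo n))

  minus-homo : ∀ x y → e (x K.- y) L.≈ e x L.- e y
  minus-homo x y = L.trans (+-homo x (K.- y)) (L.+-congˡ (-‿homo y))

module ExtensionProperties {c ℓ₁ ℓ₂ c′ ℓ₁′ ℓ₂′} {K : ValuedField c ℓ₁ ℓ₂} {L : ValuedField c′ ℓ₁′ ℓ₂′}
         (E : ValuedExtension K L) where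
  private
    module K = ValuedField K
    module L = ValuedField L
  open ValuedExtension E
  open RingMorphisms.IsRingHomomorphism isFieldHom

  -- An embedding only reflects x # 0# up to double negation, which suffices
  -- as _≤_ on ℚ is stable.
  ≤v-embed : ∀ {q x} → q K.≤v x → q L.≤v embed x
  ≤v-embed {q} {x} q≤x ex#0 with q ℚ.≤? L.v ex#0
  ... | yes q≤ = q≤
  ... | no  q≰ = ⊥-elim (L.#-irrefl ex≈0 ex#0)
    where
    ¬x#0 : ¬ x K.# K.0#
    ¬x#0 x#0 = q≰ (ℚ.≤-trans (q≤x x#0) (ℚ.≤-reflexive (≡.sym (v-extends x#0 ex#0))))
    ex≈0 = L.trans (⟦⟧-cong (proj₁ (K.tight x K.0#) ¬x#0)) 0#-homo

-- Alternating sums and parity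

module AlternatingSums {c ℓ₁ ℓ₂} (F : HeytingField c ℓ₁ ℓ₂) where
  open FieldOps F
  open Exp semiring using (^-assocʳ; ^-congˡ)
  open FiniteSums F
  open SemiringSolver commutativeSemiring using (solve; _:+_; _:*_; _:=_; con)
  open Ring (CommutativeRing.ring (Defs.ring F)) using (-1*x≈-x; -‿involutive)
  open ≈-Reasoning setoid

  -- Doubling turns each summand into `G (suc n) + G n` with sign, so neighbours cancel. The last
  -- boundary term stays on the left, with a sign that depends on `m`.
  alternating-telescope : ∀ (G g : ℕ → Carrier) → (∀ n → G (suc n) + G n ≈ (1# + 1#) * g n) → ∀ m →
    (1# + 1#) * ∑[ x < m ] (g (toℕ x) * (- 1#) ^ toℕ x) + (- 1#) ^ m * G m ≈ G 0
  alternating-telescope G g G⁺+G≈2g zero    = solve 1 (λ y → (con 1 :+ con 1) :* con 0 :+ con 1 :* y := y) refl (G 0)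
  alternating-telescope G g G⁺+G≈2g (suc m) = begin
    2# * ∑[ x ≤ m ] (g (toℕ x) * (- 1#) ^ toℕ x) + - 1# * e * G (suc m)
      ≈⟨ +-congʳ (*-congˡ (∑-snoc m (λ x → g x * (- 1#) ^ x))) ⟩
    2# * (S + g m * e) + - 1# * e * G (suc m)
      ≈⟨ solve 5 (λ S g e n G⁺ → (con 1 :+ con 1) :* (S :+ g :* e) :+ n :* e :* G⁺
           := (con 1 :+ con 1) :* S :+ e :* ((con 1 :+ con 1) :* g) :+ n :* e :* G⁺) refl S (g m) e (- 1#) (G (suc m)) ⟩
    2# * S + e * (2# * g m) + - 1# * e * G (suc m)
      ≈⟨ +-congʳ (+-congˡ (*-congˡ (G⁺+G≈2g m))) ⟨
    2# * S + e * (G (suc m) + G m) + - 1# * e * G (suc m)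
      -- To the solver `- 1#` is a variable `n`; the terms with `G (suc m)` are collected under the
      -- factor `1# - 1#`, which vanishes next.
      ≈⟨ solve 5 (λ S e n G⁺ G → (con 1 :+ con 1) :* S :+ e :* (G⁺ :+ G) :+ n :* e :* G⁺
           := (con 1 :+ con 1) :* S :+ e :* G :+ (con 1 :+ n) :* (e :* G⁺)) refl S e (- 1#) (G (suc m)) (G m) ⟩
    2# * S + e * G m + (1# - 1#) * (e * G (suc m))
      ≈⟨ +-cong (alternating-telescope G g G⁺+G≈2g m) (trans (*-congʳ (-‿inverseʳ 1#)) (zeroˡ _)) ⟩
    G 0 + 0#
      ≈⟨ +-identityʳ (G 0) ⟩
    G 0 ∎
    where
    2# = 1# + 1#
    e  = (- 1#) ^ m
    S  = ∑[ x < m ] (g (toℕ x) * (- 1#) ^ toℕ x)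

  [-1]*[-1]≈1 : - 1# * - 1# ≈ 1#
  [-1]*[-1]≈1 = trans (-1*x≈-x (- 1#)) (-‿involutive 1#)

  2∤n⇒[-1]^n≈-1 : ∀ n → ¬ 2 ∣ n → (- 1#) ^ n ≈ - 1#
  2∤n⇒[-1]^n≈-1 0 2∤0 = ⊥-elim (2∤0 (divides 0 ≡.refl))
  2∤n⇒[-1]^n≈-1 1 _   = *-identityʳ (- 1#)
  2∤n⇒[-1]^n≈-1 (suc (suc n)) 2∤2+n = begin
    - 1# * (- 1# * (- 1#) ^ n)  ≈⟨ *-assoc _ _ _ ⟨
    - 1# * - 1# * (- 1#) ^ n    ≈⟨ *-cong [-1]*[-1]≈1 (2∤n⇒[-1]^n≈-1 n 2∤n) ⟩
    1# * - 1#                   ≈⟨ *-identityˡ _ ⟩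
    - 1#                        ∎
    where
    2∤n : ¬ 2 ∣ n
    2∤n (divides k n≡k*2) = 2∤2+n (divides (suc k) (≡.cong (λ m → suc (suc m)) n≡k*2))

  [-1]^[p^n]≈-1 : ∀ p → ¬ 2 ∣ p → ∀ n → (- 1#) ^ (p ℕ.^ n) ≈ - 1#
  [-1]^[p^n]≈-1 p 2∤p zero    = *-identityʳ (- 1#)
  [-1]^[p^n]≈-1 p 2∤p (suc n) = begin
    (- 1#) ^ (p ℕ.* p ℕ.^ n)    ≈⟨ ^-assocʳ (- 1#) p (p ℕ.^ n) ⟨
    ((- 1#) ^ p) ^ (p ℕ.^ n)    ≈⟨ ^-congˡ (p ℕ.^ n) (2∤n⇒[-1]^n≈-1 p 2∤p) ⟩
    (- 1#) ^ (p ℕ.^ n)          ≈⟨ [-1]^[p^n]≈-1 p 2∤p n ⟩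
    - 1#                        ∎

prime≢2⇒2∤ : ∀ {p} → Prime p → p ≢ 2 → ¬ 2 ∣ p
prime≢2⇒2∤ prime-p p≢2 2∣p with prime⇒irreducible prime-p 2∣p
... | inj₁ ()
... | inj₂ 2≡p = p≢2 (≡.sym 2≡p)

-- Fermionic integrals of polynomials

module FermionicIntegrals {c ℓ₁ ℓ₂} {p : ℕ} (prime-p : Prime p) (p≢2 : p ≢ 2)
         (T : PadicTower p c ℓ₁ ℓ₂) where
  open PadicTower T
  open Fermionic T
  open ValuedField ℂₚ
  open Polynomials heytingField
  open Umbral heytingField ℚ→ℂₚ ℚ→ℂₚ-isFieldHom
  open ValuationProperties ℂₚ
  open UmbralCalculus heytingField ℚ→ℂₚ ℚ→ℂₚ-isFieldHom
  open AppellSequences heytingField ℚ→ℂₚ ℚ→ℂₚ-isFieldHom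
  open PowerSeriesAlgebra heytingField ℚ→ℂₚ ℚ→ℂₚ-isFieldHom
  open Exponential heytingField ℚ→ℂₚ ℚ→ℂₚ-isFieldHom
  open FiniteSums heytingField
  open AlternatingSums heytingField
  open SemiringSolver commutativeSemiring using (solve; _:+_; _:*_; _:=_; con)
  open ≈-Reasoning setoid
  private
    module Q = ValuedField ℚₚ
    module E₁ = Completion ℚ⊂ℚₚ
    module E₂ = AlgebraicClosure ℚₚ⊂ℚ̄ₚ
    module E₃ = Completion ℚ̄ₚ⊂ℂₚ

  ℚₚ→ℂₚ-isFieldHom : IsFieldHom Q.heytingField heytingField ℚₚ→ℂₚ
  ℚₚ→ℂₚ-isFieldHom = isRingHomomorphism trans E₂.isFieldHom E₃.isFieldHom

  open FieldHomomorphisms Q.heytingField heytingField ℚₚ→ℂₚ ℚₚ→ℂₚ-isFieldHom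

  ≤v-ℚₚ→ℂₚ : ∀ {q x} → q Q.≤v x → q ≤v ℚₚ→ℂₚ x
  ≤v-ℚₚ→ℂₚ q≤x = ExtensionProperties.≤v-embed E₃.extension (ExtensionProperties.≤v-embed E₂.extension q≤x)

  p∤1 : ¬ p ∣ 1
  p∤1 p∣1 = ¬prime[1] (≡.subst Prime (∣1⇒≡1 p∣1) prime-p)

  -- In the rationals this is `isPadic` with cofactor 1; the bound then passes through the three
  -- embeddings of the tower.
  n≤v[p^n] : ∀ n → ℤ→ℚ (+ n) ≤v (p ℕ.^ n) ℕ· 1#
  n≤v[p^n] n = ≤v-cong (ℚ→F-ℕ (p ℕ.^ n))
    (≤v-ℚₚ→ℂₚ (ExtensionProperties.≤v-embed E₁.extension n≤v))
    where
    n≤v : ValuedField._≤v_ ℚᵥ (ℤ→ℚ (+ n)) (ℤ→ℚ (+ (p ℕ.^ n)))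
    n≤v = ≡.subst (λ a → ValuedField._≤v_ ℚᵥ (ℤ→ℚ (+ n)) (ℤ→ℚ a)) (ℤ.*-identityʳ (+ (p ℕ.^ n)))
      λ x#0 → ℚ.≤-reflexive (≡.sym (isPadic n (+ 1) p∤1 x#0))

  ∫-cong : ∀ {f g I} → (∀ x → f x ≈ g x) → ∫ f ≔ I → ∫ g ≔ I
  ∫-cong {f} {g} {I} f≈g (f-continuous , f⟶I) =
    (λ x B → let δ , small = f-continuous x B in
       δ , λ y δ≤y-x → ≤v-cong (+-cong (f≈g y) (-‿cong (f≈g x))) (small y δ≤y-x)) ,
    λ B → let N , small = f⟶I B in
       N , λ n N≤n → ≤v-cong (+-congʳ (sums≈ n)) (small n N≤n)
    where
    sums≈ : ∀ n → fermionicSum f n ≈ fermionicSum g n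
    sums≈ n = sum-cong-≋ {p ℕ.^ n} λ x → *-congʳ (f≈g (ℕ→ℤₚ (toℕ x)))

  -- The integrand changes only under the innermost integral; the intermediate function `h` is kept,
  -- and the value is replaced at the end of the iteration.
  ∫ⁿ-cong : ∀ {n f g I J} → (∀ xs → f xs ≈ g xs) → I ≈ J → ∫ⁿ n f I → ∫ⁿ n g J
  ∫ⁿ-cong f≈g I≈J (none f≈I)     = none (trans (sym (f≈g _)) (trans f≈I I≈J))
  ∫ⁿ-cong f≈g I≈J (step h ∫f ∫h) =
    step h (λ xs → ∫-cong (λ x → f≈g (x ∷ xs)) (∫f xs)) (∫ⁿ-cong (λ _ → refl) I≈J ∫h)

  polynomial-continuous : ∀ q s → Continuous (λ x → ⟦ q ⟧ (ℤₚ→ℂₚ x + s))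
  polynomial-continuous q s x B =
    δ , λ y δ≤y-x → ≤v-cong (+-congʳ (⟦⟧-cong q (shift y)))
      (small (ℚₚ→ℂₚ (proj₁ y Q.- proj₁ x)) (≤v-ℚₚ→ℂₚ δ≤y-x))
    where
    δ     = proj₁ (⟦⟧-continuous q (ℤₚ→ℂₚ x + s) B)
    small = proj₂ (⟦⟧-continuous q (ℤₚ→ℂₚ x + s) B)
    shift : ∀ y → ℤₚ→ℂₚ x + s + ℚₚ→ℂₚ (proj₁ y Q.- proj₁ x) ≈ ℤₚ→ℂₚ y + s
    shift y = begin
      ℤₚ→ℂₚ x + s + ℚₚ→ℂₚ (proj₁ y Q.- proj₁ x)
        ≈⟨ +-congˡ (minus-homo (proj₁ y) (proj₁ x)) ⟩
      ℤₚ→ℂₚ x + s + (ℤₚ→ℂₚ y - ℤₚ→ℂₚ x)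
        ≈⟨ solve 3 (λ x s d → x :+ s :+ d := x :+ d :+ s) refl (ℤₚ→ℂₚ x) s (ℤₚ→ℂₚ y - ℤₚ→ℂₚ x) ⟩
      ℤₚ→ℂₚ x + (ℤₚ→ℂₚ y - ℤₚ→ℂₚ x) + s
        ≈⟨ +-congʳ (y+[x-y]≈x (ℤₚ→ℂₚ y) (ℤₚ→ℂₚ x)) ⟩
      ℤₚ→ℂₚ y + s ∎

  -- The error of the partial sum is half an increment of the polynomial `Q`, the form that
  -- `⟦⟧-continuous` controls.
  fermionicSum-polynomial : ∀ q s n → let Q = 2/[eᵗ+1] ▹ q in
    inv 2#0 * (⟦ Q ⟧ (s + (p ℕ.^ n) ℕ· 1#) - ⟦ Q ⟧ s) ≈ fermionicSum (λ x → ⟦ q ⟧ (ℤₚ→ℂₚ x + s)) n - ⟦ Q ⟧ s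
  fermionicSum-polynomial q s n = x+y≈z⇒x≈z-y (begin
    inv 2#0 * D + G₀
      ≈⟨ +-congˡ (trans (sym (*-identityˡ G₀)) (*-congʳ (sym (inv-inverse 2#0)))) ⟩
    inv 2#0 * D + (1# + 1#) * inv 2#0 * G₀
      ≈⟨ solve 3 (λ i D G → i :* D :+ (con 1 :+ con 1) :* i :* G := i :* (G :+ D :+ G)) refl (inv 2#0) D G₀ ⟩
    inv 2#0 * (G₀ + D + G₀)
      ≈⟨ *-congˡ (+-congʳ (y+[x-y]≈x (⟦ Q ⟧ (s + m ℕ· 1#)) G₀)) ⟩
    inv 2#0 * (⟦ Q ⟧ (s + m ℕ· 1#) + G₀)
      ≈⟨ *-congˡ (+-cong (⟦⟧-cong Q (+-comm s (m ℕ· 1#))) (⟦⟧-cong Q (sym (+-identityˡ s)))) ⟩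
    inv 2#0 * (G m + G 0)
      ≈⟨ *-congˡ doubled ⟨
    inv 2#0 * ((1# + 1#) * S)
      ≈⟨ solve 2 (λ i S → i :* ((con 1 :+ con 1) :* S) := (con 1 :+ con 1) :* i :* S) refl (inv 2#0) S ⟩
    (1# + 1#) * inv 2#0 * S
      ≈⟨ trans (*-congʳ (inv-inverse 2#0)) (*-identityˡ S) ⟩
    S ∎)
    where
    Q  = 2/[eᵗ+1] ▹ q
    m  = p ℕ.^ n
    G₀ = ⟦ Q ⟧ s
    D  = ⟦ Q ⟧ (s + m ℕ· 1#) - G₀
    S  = fermionicSum (λ x → ⟦ q ⟧ (ℤₚ→ℂₚ x + s)) n
    G g : ℕ → Carrier
    G k = ⟦ Q ⟧ (k ℕ· 1# + s)
    g k = ⟦ q ⟧ (k ℕ· 1# + s)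
    G⁺+G≈2g : ∀ k → G (suc k) + G k ≈ (1# + 1#) * g k
    G⁺+G≈2g k = trans (+-congʳ (⟦⟧-cong Q (+-assoc 1# (k ℕ· 1#) s))) (⟦2/[eᵗ+1]▹⟧ q (k ℕ· 1# + s))
    S≈ : S ≈ ∑[ x < m ] (g (toℕ x) * (- 1#) ^ toℕ x)
    S≈ = sum-cong-≋ {m} λ x → *-congʳ (⟦⟧-cong q (+-congʳ (×1-homo (toℕ x))))
    doubled : (1# + 1#) * S ≈ G m + G 0
    doubled = begin
      (1# + 1#) * S
        ≈⟨ *-congˡ S≈ ⟩
      Σ₂
        ≈⟨ y+[x-y]≈x Σ₂ (G 0) ⟨
      G 0 + (Σ₂ - G 0)
        ≈⟨ +-congˡ (sym (x+y≈z⇒x≈z-y G+G≈)) ⟩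
      G 0 + G m
        ≈⟨ +-comm (G 0) (G m) ⟩
      G m + G 0 ∎
      where
      Σ₂ = (1# + 1#) * ∑[ x < m ] (g (toℕ x) * (- 1#) ^ toℕ x)
      G+G≈ : G m + G 0 ≈ Σ₂
      G+G≈ = begin
        G m + G 0
          ≈⟨ +-congˡ (alternating-telescope G g G⁺+G≈2g m) ⟨
        G m + (Σ₂ + (- 1#) ^ m * G m)
          -- An odd number of terms gives the boundary term `G m` the sign that cancels the added
          -- `G m`.
          ≈⟨ +-congˡ (+-congˡ (*-congʳ ([-1]^[p^n]≈-1 p (prime≢2⇒2∤ prime-p p≢2) n))) ⟩
        G m + (Σ₂ + - 1# * G m)
          ≈⟨ solve 3 (λ G S e → G :+ (S :+ e :* G) := S :+ (con 1 :+ e) :* G) refl (G m) Σ₂ (- 1#) ⟩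
        Σ₂ + (1# - 1#) * G m
          ≈⟨ +-congˡ (trans (*-congʳ (-‿inverseʳ 1#)) (zeroˡ (G m))) ⟩
        Σ₂ + 0#
          ≈⟨ +-identityʳ Σ₂ ⟩
        Σ₂ ∎

  ∫-polynomial : ∀ q s → ∫ (λ x → ⟦ q ⟧ (ℤₚ→ℂₚ x + s)) ≔ ⟦ 2/[eᵗ+1] ▹ q ⟧ s
  ∫-polynomial q s = polynomial-continuous q s , λ B →
    -- `B₂` accounts for the factor one half, so the increment needs only `B ℚ.- B₂`. The absolute
    -- numerator of `δ` is an index beyond which the shift has valuation at least `δ`.
    let B₂ , B₂≤ = ≤v-bound (inv 2#0)
        δ , small = ⟦⟧-continuous (2/[eᵗ+1] ▹ q) s (B ℚ.- B₂)
    in ℤ.∣ ℚ.↥ δ ∣ , λ n δ≤n → ≤v-cong (fermionicSum-polynomial q s n)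
         (≡.subst (_≤v _) (p+[q-p]≡q B₂ B)
           (≤v-* B₂≤ (small ((p ℕ.^ n) ℕ· 1#) (≤v-weaken (∣numerator∣≤n⇒≤n δ n δ≤n) (n≤v[p^n] n)))))

  -- The innermost integral replaces `q` by `2/[eᵗ+1] ▹ q`, evaluated at the sum of the remaining
  -- variables and `x`, so the induction is over all `q`.
  ∫ⁿ-polynomial : ∀ r q x → ∫ⁿ r (λ xs → ⟦ q ⟧ (total xs + x)) (⟦ (2/[eᵗ+1] ^ₛ r) ▹ q ⟧ x)
  ∫ⁿ-polynomial zero    q x = none (trans (⟦⟧-cong q (+-identityˡ x)) (sym (⟦1▹⟧ q x)))
  ∫ⁿ-polynomial (suc r) q x = step (λ xs → ⟦ 2/[eᵗ+1] ▹ q ⟧ (total xs + x))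
    (λ xs → ∫-cong (λ y → ⟦⟧-cong q (sym (+-assoc (ℤₚ→ℂₚ y) (total xs) x))) (∫-polynomial q (total xs + x)))
    (∫ⁿ-cong (λ _ → refl) (⟦▹▹⟧ (2/[eᵗ+1] ^ₛ r) 2/[eᵗ+1] q x) (∫ⁿ-polynomial r (2/[eᵗ+1] ▹ q) x))

  -- Defined from the target series, so that `egf` returns it at once; `∫ⁿ-moment` identifies it
  -- with the integral.
  moment : ℕ → ℕ → Carrier
  moment r k = (k !) ℕ· (2/[eᵗ+1] ^ₛ r) k

  egf-moment : ∀ r → egf (moment r) ≈ₛ 2/[eᵗ+1] ^ₛ r
  egf-moment r k = 1/n!-× k ((2/[eᵗ+1] ^ₛ r) k)

  -- The case of a monomial at `x` equal to 0, where evaluation picks out the `k`-th coefficient of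
  -- the series times `k !`.
  ∫ⁿ-moment : ∀ r k → ∫ⁿ r (λ xs → total xs ^ k) (moment r k)
  ∫ⁿ-moment r k = ∫ⁿ-cong (λ xs → trans (⟦X^⟧ (total xs + 0#)) (^-congˡ k (+-identityʳ (total xs)))) value
    (∫ⁿ-polynomial r (X^ k) 0#)
    where
    open Exp semiring using (^-congˡ)
    A^r = 2/[eᵗ+1] ^ₛ r
    ⟦X^⟧ : ∀ y → ⟦ X^ k ⟧ y ≈ y ^ k
    ⟦X^⟧ y = trans (⟦⟧-exp (X^ k) y) (trans (⟨∣⟩-X^ (exp y) k) (×-1/n! k (y ^ k)))
    value : ⟦ A^r ▹ X^ k ⟧ 0# ≈ moment r k
    value = begin
      ⟦ A^r ▹ X^ k ⟧ 0#              ≈⟨ ⟦▹⟧ A^r (X^ k) 0# ⟩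
      ⟨ exp 0# *ₛ A^r ∣ X^ k ⟩       ≈⟨ ⟨∣⟩-X^ (exp 0# *ₛ A^r) k ⟩
      (k !) ℕ· (exp 0# *ₛ A^r) k     ≈⟨ ×-congʳ (k !) (*ₛ-cong {g = A^r} exp-0 (λ _ → refl) k) ⟩
      (k !) ℕ· (const 1# *ₛ A^r) k   ≈⟨ ×-congʳ (k !) (*ₛ-identityˡ A^r k) ⟩
      moment r k                     ∎

  egf-moment-head#0 : ∀ r → egf (moment r) 0 # 0#
  egf-moment-head#0 r = #-congʳ (HeytingField.heytingCommutativeRing heytingField)
    (sym (egf-moment r 0)) (^ₛ-head#0 2/[eᵗ+1] 2/[eᵗ+1]-head#0 r)

  euler-appell : ∀ r → Appell (quotient (const 1#) (egf (moment r)) (egf-moment-head#0 r)) (euler r)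
  euler-appell r = appell (quotient (const 1#) (egf (moment r)) (egf-moment-head#0 r)) (2/[eᵗ+1] ^ₛ r)
    (quotient-*ₛ-cong (const 1#) (egf-moment-head#0 r) (egf-moment r)) (euler r) (▹X^≋*ₓeˣᵗ (2/[eᵗ+1] ^ₛ r))

-- Integral formula, Euler polynomials and the Appell property

theorem2p3 :
  ∀ {c ℓ₁ ℓ₂} (p : ℕ) → Prime p → p ≢ 2 → (T : PadicTower p c ℓ₁ ℓ₂) →
  let open PadicTower T
      open Fermionic T
      open ValuedField ℂₚ
      open Polynomials heytingField
      open Umbral heytingField ℚ→ℂₚ ℚ→ℂₚ-isFieldHom
  in
  (r : ℕ) → 1 ≤ r →
  ((q : Poly) (x : Carrier) →
    ∫ⁿ r (λ xs → ⟦ q ⟧ (total xs + x)) (⟦ (2/[eᵗ+1] ^ₛ r) ▹ q ⟧ x))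
  ×
  (Σ[ moment ∈ (ℕ → Carrier) ]
    ((k : ℕ) → ∫ⁿ r (λ xs → total xs ^ k) (moment k))
    ×
    ((n : ℕ) →
      (euler r n ≋ (2/[eᵗ+1] ^ₛ r) ▹ X^ n) ×
      ((2/[eᵗ+1] ^ₛ r) ▹ X^ n ≋ egf moment ▹ X^ n))
    ×
    (Σ[ invertible ∈ egf moment 0 # 0# ]
      Appell (quotient (const 1#) (egf moment) invertible) (euler r)))
theorem2p3 p prime-p p≢2 T r _ =
  ∫ⁿ-polynomial r ,
  moment r ,
  ∫ⁿ-moment r ,
  (λ n → ▹X^≋*ₓeˣᵗ (2/[eᵗ+1] ^ₛ r) n ,
         ▹-cong (X^ n) (λ k → sym (egf-moment r k))) ,
  egf-moment-head#0 r ,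
  euler-appell r
  where
  open PadicTower T
  open ValuedField ℂₚ
  open Polynomials heytingField
  open Umbral heytingField ℚ→ℂₚ ℚ→ℂₚ-isFieldHom
  open UmbralCalculus heytingField ℚ→ℂₚ ℚ→ℂₚ-isFieldHom
  open AppellSequences heytingField ℚ→ℂₚ ℚ→ℂₚ-isFieldHom
  open FermionicIntegrals prime-p p≢2 T
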